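{- For integers $n\ge 1$ and $k\ge 0$, let $CT(n,k)$ be the number of set partitions of $[n]$ with exactly $k$ arcs that contain no right crossings. Then, as formal power series in $x$ and $y$, $$\sum_{n\geq 1}\sum_{k=0}^{n-1}CT(n,k)\,x^n y^k=\sum_{n\geq 1}\frac{x^n(1+xy)^{\binom{n}{2}}}{\prod_{k=0}^{n-1}\bigl(1-(1+xy)^k xy\bigr)}.$$
   Context: $[n]=\{1,2,\ldots,n\}$. The arcs of a set partition $\pi$ of $[n]$ are those of its linear representation: for each block $\{i_1<i_2<\cdots<i_r\}$ of $\pi$, the arcs are the pairs $(i_1,i_2),(i_2,i_3),\ldots,(i_{r-1},i_r)$ of consecutive elements of the block (a singleton block gives no arc). A right crossing of $\pi$ is a pair of arcs $(i_1,j_1)$, $(i_2,j_2)$ of $\pi$ with $i_1<i_2<j_1<j_2$ and $j_2=j_1+1$. -}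

module Defs where

open import Algebra.Bundles.Raw using (RawRing)
import Algebra.Definitions
import Algebra.Definitions.RawMonoid
import Algebra.Definitions.RawSemiring
open import Data.Bool.Base using (if_then_else_; _∧_)
open import Data.Fin.Base using (Fin; toℕ; _<_)
open import Data.Fin.Properties using (all?; _<?_)
open import Data.Fin.Subset using (Subset; inside; outside; _∈_; _∉_; _∩_; Nonempty; Empty)
open import Data.Fin.Subset.Properties using (_∈?_; nonempty?)
open import Data.Integer.Base as ℤ using (ℤ; 0ℤ; 1ℤ)
open import Data.List.Base using (List; []; _∷_; _++_; map; filter; length; allFin; cartesianProduct)
open import Data.List.Relation.Unary.All as All using (All)
open import Data.List.Relation.Unary.AllPairs using (AllPairs; allPairs?)
open import Data.List.Relation.Unary.Any as Any using (Any)
open import Data.Nat.Base as ℕ using (ℕ; zero; suc; _≤_; _∸_; _≡ᵇ_)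
import Data.Nat.Properties as ℕ
open import Data.Product.Base using (∃-syntax; _×_; _,_)
open import Data.Vec.Base using ([]; _∷_)
open import Relation.Binary.PropositionalEquality using (_≡_)
open import Relation.Nullary using (¬_; Dec; ¬?; _×-dec_; _→-dec_)
open import Relation.Unary using (Decidable)

------------------------------------------------------------------------
-- Set partitions. The element i of Fin n stands for toℕ i + 1 in [n].

subsets : ∀ n → List (Subset n)
subsets zero    = [] ∷ []
subsets (suc n) = map (outside ∷_) (subsets n) ++ map (inside ∷_) (subsets n)

sublists : ∀ {A : Set} → List A → List (List A)
sublists []       = [] ∷ []
sublists (x ∷ xs) = sublists xs ++ map (x ∷_) (sublists xs)

IsSetPartition : ∀ {n} → List (Subset n) → Set
IsSetPartition {n} π =
    All Nonempty π
  × AllPairs (λ A B → Empty (A ∩ B)) π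
  × (∀ (i : Fin n) → Any (i ∈_) π)

isSetPartition? : ∀ {n} → Decidable (IsSetPartition {n})
isSetPartition? π =
        All.all? nonempty? π
  ×-dec allPairs? (λ A B → ¬? (nonempty? (A ∩ B))) π
  ×-dec all? (λ i → Any.any? (i ∈?_) π)

-- Since `subsets n` has no repetitions, its sublists represent each set of
-- subsets of [n] exactly once, so each set partition is listed exactly once.
setPartitions : ∀ n → List (List (Subset n))
setPartitions n = filter isSetPartition? (sublists (subsets n))

Consecutive : ∀ {n} → Subset n → Fin n → Fin n → Set
Consecutive {n} B i j =
  i ∈ B × j ∈ B × i < j × (∀ (l : Fin n) → i < l → l < j → l ∉ B)

consecutive? : ∀ {n} (B : Subset n) i j → Dec (Consecutive B i j)
consecutive? B i j =
        i ∈? B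
  ×-dec j ∈? B
  ×-dec i <? j
  ×-dec all? (λ l → i <? l →-dec l <? j →-dec ¬? (l ∈? B))

IsArc : ∀ {n} → List (Subset n) → Fin n × Fin n → Set
IsArc π (i , j) = Any (λ B → Consecutive B i j) π

isArc? : ∀ {n} (π : List (Subset n)) → Decidable (IsArc π)
isArc? π (i , j) = Any.any? (λ B → consecutive? B i j) π

arcs : ∀ {n} → List (Subset n) → List (Fin n × Fin n)
arcs {n} π = filter (isArc? π) (cartesianProduct (allFin n) (allFin n))

RightCrossing : ∀ {n} → Fin n × Fin n → Fin n × Fin n → Set
RightCrossing (i₁ , j₁) (i₂ , j₂) =
  i₁ < i₂ × i₂ < j₁ × j₁ < j₂ × toℕ j₂ ≡ suc (toℕ j₁)

rightCrossing? : ∀ {n} (a b : Fin n × Fin n) → Dec (RightCrossing a b)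
rightCrossing? (i₁ , j₁) (i₂ , j₂) =
  i₁ <? i₂ ×-dec i₂ <? j₁ ×-dec j₁ <? j₂ ×-dec toℕ j₂ ℕ.≟ suc (toℕ j₁)

HasRightCrossing : ∀ {n} → List (Subset n) → Set
HasRightCrossing π = Any (λ a → Any (RightCrossing a) (arcs π)) (arcs π)

hasRightCrossing? : ∀ {n} → Decidable (HasRightCrossing {n})
hasRightCrossing? π =
  Any.any? (λ a → Any.any? (rightCrossing? a) (arcs π)) (arcs π)

CT : ℕ → ℕ → ℕ
CT n k = length (filter counted? (setPartitions n))
  where
  counted? : Decidable (λ π → length (arcs π) ≡ k × ¬ HasRightCrossing π)
  counted? π = length (arcs π) ℕ.≟ k ×-dec ¬? (hasRightCrossing? π)

------------------------------------------------------------------------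
-- The ring ℤ[[x, y]]; `f i j` is the coefficient of xⁱ yʲ in f.

PowerSeries : Set
PowerSeries = ℕ → ℕ → ℤ

monomial : ℕ → ℕ → PowerSeries
monomial a b i j = if (i ≡ᵇ a) ∧ (j ≡ᵇ b) then 1ℤ else 0ℤ

private
  module ℤΣ = Algebra.Definitions.RawMonoid ℤ.+-0-rawMonoid

powerSeriesRing : RawRing _ _
powerSeriesRing = record
  { Carrier = PowerSeries
  ; _≈_     = λ f g → ∀ i j → f i j ≡ g i j
  ; _+_     = λ f g i j → f i j ℤ.+ g i j
  ; _*_     = λ f g i j →
      ℤΣ.sum {suc i} λ a → ℤΣ.sum {suc j} λ b →
        f (toℕ a) (toℕ b) ℤ.* g (i ∸ toℕ a) (j ∸ toℕ b)
  ; -_      = λ f i j → ℤ.- f i j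
  ; 0#      = λ _ _ → 0ℤ
  ; 1#      = monomial 0 0
  }

open RawRing powerSeriesRing public
  using (_≈_; _+_; _*_; -_; 0#; 1#; rawSemiring)

open Algebra.Definitions.RawSemiring rawSemiring public
  using (_^_; sum; product) renaming (_×_ to _·_)

open Algebra.Definitions _≈_ using (Invertible)

infixl 6 _-_
_-_ : PowerSeries → PowerSeries → PowerSeries
f - g = f + (- g)

x y : PowerSeries
x = monomial 1 0
y = monomial 0 1

-- q = f / g. Invertibility of g makes such a q exist and be unique up to _≈_.
IsQuotient : (q f g : PowerSeries) → Set
IsQuotient q f g = Invertible 1# _*_ g × q * g ≈ f

-- s = Σ_{n ≥ 1} f n as formal power series: the coefficient of each monomial
-- in the partial sums f 1 + ⋯ + f m is eventually constant, equal to that in s.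
-- The value f 0 is not used.
HasSum : (ℕ → PowerSeries) → PowerSeries → Set
HasSum f s = ∀ i j → ∃[ M ] (∀ m → M ≤ m →
  sum {m} (λ n → f (suc (toℕ n))) i j ≡ s i j)

{-# OPTIONS --safe #-}
-- Build a partition by adding the elements in increasing order, and keep its blocks sorted by greatest
-- element so far, largest first. A new element starts a block or joins one of the existing blocks,
-- which then moves to the front. If it joins the block in position p, the next element creates no
-- right crossing exactly when it starts a block, joins the block in position 0, or joins one in a
-- position > p: the blocks in positions > p have not moved, and those in positions 1, …, p have a
-- greatest element above the opener of the arc just added. The admissible choices thus depend only on
-- p and on the number of blocks. With Φ a s the generating function of the continuations from a + 1
-- blocks when s of the positions > 0 are admissible,
--   Φ a (s + 1) = (1 + xy) Φ a s   and   Φ a 0 = 1 + x Φ (a + 1) (a + 1) + xy Φ a a,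
-- so (1 - (1 + xy)ᵃ xy) Φ a 0 = 1 + x (1 + xy)ᵃ⁺¹ Φ (a + 1) 0, and the left-hand side of the theorem,
-- x Φ 0 0, unrolls to the right-hand side.
module Submission where

open import Algebra.Bundles using (CommutativeRing; Monoid)
import Algebra.Definitions.RawMonoid
import Algebra.Morphism.RingMonomorphism
open import Algebra.Morphism.Structures using (IsRingMonomorphism)
import Algebra.Properties.CommutativeMonoid.Sum
import Algebra.Properties.CommutativeSemigroup
import Algebra.Properties.Monoid.Sum
import Algebra.Properties.Ring
import Algebra.Properties.Semiring.Exp
import Algebra.Properties.Semiring.Sum
open import Data.Bool.Base using (true; false)
import Data.Bool.Properties as Bool
open import Data.Empty using (⊥)
open import Data.Fin.Base as Fin using (Fin; toℕ; fromℕ<)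
import Data.Fin.Properties as Fin
open import Data.Fin.Subset using (Subset; inside; outside; _∩_) renaming (_∈_ to _∈ₛ_)
open import Data.Fin.Subset.Properties using (⊆-antisym; x∈p∩q⁺; x∈p∩q⁻; _∈?_)
open import Data.Integer.Base as ℤ using (ℤ; 0ℤ; 1ℤ)
import Data.Integer.Properties as ℤ
open import Data.List.Base
  using (List; []; _∷_; _++_; _∷ʳ_; map; length; filter; allFin; cartesianProduct; cartesianProductWith)
open import Data.List.Membership.Propositional using (_∈_; _∉_; find; lose)
open import Data.List.Membership.Propositional.Properties
open import Data.List.Membership.Propositional.Properties.WithK using (unique∧set⇒bag)
open import Data.List.Properties
  using (length-++; length-map; ∷-injectiveʳ; ++-assoc; ++-identityʳ; ∷ʳ-++)
open import Data.List.Relation.Binary.BagAndSetEquality using (∼bag⇒↭)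
open import Data.List.Relation.Binary.Permutation.Propositional.Properties using (↭-length)
open import Data.List.Relation.Unary.All as All using (All; []; _∷_)
import Data.List.Relation.Unary.All.Properties as All
open import Data.List.Relation.Unary.AllPairs as AllPairs using (AllPairs; []; _∷_)
import Data.List.Relation.Unary.AllPairs.Properties as AllPairs
open import Data.List.Relation.Unary.Any as Any using (here; there)
open import Data.List.Relation.Unary.Unique.Propositional using (Unique)
import Data.List.Relation.Unary.Unique.Propositional.Properties as Unique
open import Data.Nat.Base as ℕ using (ℕ; zero; suc; _∸_; _<_; _>_; _≤_; _≥_; z≤n; s≤s)
open import Data.Nat.Combinatorics using (_C_; nC1≡n; nCk+nC[k+1]≡[n+1]C[k+1])
open import Data.Nat.Induction using (<-rec)
import Data.Nat.Properties as ℕ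
open import Data.Product.Base using (_,_; _×_; proj₁; proj₂; ∃-syntax)
open import Data.Sum.Base using (_⊎_; inj₁; inj₂)
import Data.Vec.Base as Vec
import Data.Vec.Properties as Vec
open import Function.Base using (_∘_)
open import Function.Bundles using (_⇔_; mk⇔; Equivalence)
open import Level using (Level; 0ℓ)
open import Relation.Binary.Core using (Rel)
open import Relation.Binary.Definitions using (tri<; tri≈; tri>)
open import Relation.Binary.PropositionalEquality as ≡ using (_≡_; _≢_; refl)
import Relation.Binary.Reasoning.Setoid
open import Relation.Nullary using (¬_; Dec; yes; no; does; contradiction; _×-dec_)
open import Relation.Nullary.Decidable using (dec-true)
open import Relation.Unary using (Pred; Decidable)

open Equivalence using (to; from)

-- Rings of power series

module MonoidLemmas {c ℓ : Level} (M : Monoid c ℓ) where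
  open Monoid M
  open Algebra.Properties.Monoid.Sum M

  sum-toℕ-last : ∀ (f : ℕ → Carrier) n →
                 sum {suc n} (λ k → f (toℕ k)) ≈ sum {n} (λ k → f (toℕ k)) ∙ f n
  sum-toℕ-last f n = trans (sum-init-last {n} (λ k → f (toℕ k))) (∙-cong
    (reflexive (sum-cong-≗ {n} λ k → ≡.cong f (Fin.toℕ-inject₁ k)))
    (reflexive (≡.cong f (Fin.toℕ-fromℕ n))))

module RingLemmas {c ℓ : Level} (R : CommutativeRing c ℓ) where
  open CommutativeRing R
  open import Algebra.Properties.Ring ring using (-‿distribˡ-*)
  open import Relation.Binary.Reasoning.Setoid setoid
  open import Algebra.Properties.CommutativeSemigroup *-commutativeSemigroup using (interchange)
  open import Algebra.Definitions.RawMonoid *-rawMonoid using () renaming (sum to ∏)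

  -- Turns a fixed-point equation into a division by `1# - r`. It serves twice: for the geometric
  -- series that invert the denominators, and for the recursion of `Φ`.
  f≈g+rf⇒f[1-r]≈g : ∀ {r f g} → f ≈ g + r * f → f * (1# - r) ≈ g
  f≈g+rf⇒f[1-r]≈g {r} {f} {g} f≈g+rf = begin
    f * (1# - r)              ≈⟨ *-comm _ _ ⟩
    (1# - r) * f              ≈⟨ distribʳ f 1# (- r) ⟩
    1# * f + - r * f          ≈⟨ +-cong (*-identityˡ f) (sym (-‿distribˡ-* r f)) ⟩
    f - r * f                 ≈⟨ +-congʳ f≈g+rf ⟩
    g + r * f - r * f         ≈⟨ +-assoc _ _ _ ⟩
    g + (r * f - r * f)       ≈⟨ +-congˡ (-‿inverseʳ (r * f)) ⟩
    g + 0#                    ≈⟨ +-identityʳ g ⟩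
    g                         ∎

  ∏-inverse : ∀ n {f g : Fin n → Carrier} → (∀ k → f k * g k ≈ 1#) → ∏ f * ∏ g ≈ 1#
  ∏-inverse zero    fg≈1 = *-identityˡ 1#
  ∏-inverse (suc n) fg≈1 = trans (interchange _ _ _ _)
    (trans (*-cong (fg≈1 Fin.zero) (∏-inverse n λ k → fg≈1 (Fin.suc k))) (*-identityˡ 1#))

  -- Multiplying the hypothesis by `c′` gives f = c′ + p c′ g. The prefactors are kept apart for the
  -- telescoping below: `a` is a numerator with successor `a * p`, and `d` a product of inverses
  -- with successor `d * c′`.
  divide-step : ∀ {f c c′ p g} a d → f * c ≈ 1# + p * g → c * c′ ≈ 1# →
                a * d * f ≈ a * (d * c′) + a * p * (d * c′) * g
  divide-step {f} {c} {c′} {p} {g} a d fc≈1+pg cc′≈1 = begin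
    a * d * f                               ≈⟨ *-congˡ (*-identityʳ f) ⟨
    a * d * (f * 1#)                        ≈⟨ *-congˡ (*-congˡ cc′≈1) ⟨
    a * d * (f * (c * c′))                  ≈⟨ *-congˡ (*-assoc f c c′) ⟨
    a * d * (f * c * c′)                    ≈⟨ *-congˡ (*-congʳ fc≈1+pg) ⟩
    a * d * ((1# + p * g) * c′)             ≈⟨ *-congˡ (distribʳ c′ 1# (p * g)) ⟩
    a * d * (1# * c′ + p * g * c′)          ≈⟨ distribˡ (a * d) _ _ ⟩
    a * d * (1# * c′) + a * d * (p * g * c′)
      ≈⟨ +-cong (*-congˡ (*-identityˡ c′)) (*-congˡ (trans (*-assoc p g c′) (*-congˡ (*-comm g c′)))) ⟩
    a * d * c′ + a * d * (p * (c′ * g))     ≈⟨ +-cong (*-assoc a d c′) (interchange a d p (c′ * g)) ⟩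
    a * (d * c′) + a * p * (d * (c′ * g))   ≈⟨ +-congˡ (*-congˡ (*-assoc d c′ g)) ⟨
    a * (d * c′) + a * p * (d * c′ * g)     ≈⟨ +-congˡ (*-assoc (a * p) (d * c′) g) ⟨
    a * (d * c′) + a * p * (d * c′) * g     ∎

-- Power series in one variable over a commutative ring.

module Univariate {c ℓ : Level} (R : CommutativeRing c ℓ) where
  private
    module R = CommutativeRing R
    open Algebra.Properties.Monoid.Sum R.+-monoid using (sum-cong-≋) renaming (sum to ∑)
    open Algebra.Properties.CommutativeMonoid.Sum R.+-commutativeMonoid using (∑-distrib-+)
    open Algebra.Properties.Semiring.Sum R.semiring using (*-distribˡ-sum)
    module ≈-Reasoning = Relation.Binary.Reasoning.Setoid R.setoid

    Series : Set c
    Series = ℕ → R.Carrier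

    infix 4 _≋_
    _≋_ : Series → Series → Set ℓ
    f ≋ g = ∀ n → f n R.≈ g n

    infixl 6 _⊕_
    _⊕_ : Series → Series → Series
    (f ⊕ g) n = f n R.+ g n

    infixl 7 _⊛_
    _⊛_ : Series → Series → Series
    (f ⊛ g) n = ∑ {suc n} λ a → f (toℕ a) R.* g (n ∸ toℕ a)

    one : Series
    one zero    = R.1#
    one (suc _) = R.0#

    tail : Series → Series
    tail f n = f (suc n)

    scale : R.Carrier → Series → Series
    scale r f n = r R.* f n

    ⊛-cong : ∀ {f f′ g g′} → f ≋ f′ → g ≋ g′ → f ⊛ g ≋ f′ ⊛ g′
    ⊛-cong f≋f′ g≋g′ n = sum-cong-≋ {suc n} λ a → R.*-cong (f≋f′ (toℕ a)) (g≋g′ (n ∸ toℕ a))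

    ⊛-distribˡ : ∀ f g h → f ⊛ (g ⊕ h) ≋ f ⊛ g ⊕ f ⊛ h
    ⊛-distribˡ f g h n = R.trans
      (sum-cong-≋ {suc n} λ a → R.distribˡ (f (toℕ a)) (g (n ∸ toℕ a)) (h (n ∸ toℕ a)))
      (∑-distrib-+ {suc n} (λ a → f (toℕ a) R.* g (n ∸ toℕ a)) (λ a → f (toℕ a) R.* h (n ∸ toℕ a)))

    scale-⊛ : ∀ r f g → scale r f ⊛ g ≋ scale r (f ⊛ g)
    scale-⊛ r f g n = R.trans
      (sum-cong-≋ {suc n} λ a → R.*-assoc r (f (toℕ a)) (g (n ∸ toℕ a)))
      (R.sym (*-distribˡ-sum {suc n} r (λ a → f (toℕ a) R.* g (n ∸ toℕ a))))

    zero-⊛ : ∀ g → (λ _ → R.0#) ⊛ g ≋ (λ _ → R.0#)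
    zero-⊛ g zero    = R.trans (R.+-identityʳ _) (R.zeroˡ _)
    zero-⊛ g (suc n) = R.trans (R.+-cong (R.zeroˡ _) (zero-⊛ g n)) (R.+-identityʳ _)

    one-⊛ : ∀ g → one ⊛ g ≋ g
    one-⊛ g zero    = R.trans (R.+-identityʳ _) (R.*-identityˡ _)
    one-⊛ g (suc n) = R.trans (R.+-cong (R.*-identityˡ _) (zero-⊛ g n)) (R.+-identityʳ _)

    -- By computation `(f ⊛ g) (suc n)` splits off its first term and continues with the tail of
    -- `f`. This is the mirror image, and commutativity follows by comparing the two.
    ⊛-sucʳ : ∀ f g n → (f ⊛ g) (suc n) R.≈ f (suc n) R.* g 0 R.+ (f ⊛ tail g) n
    ⊛-sucʳ f g zero = begin
      f 0 R.* g 1 R.+ (f 1 R.* g 0 R.+ R.0#)   ≈⟨ R.+-cong (R.sym (R.+-identityʳ _)) (R.+-identityʳ _) ⟩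
      (f 0 R.* g 1 R.+ R.0#) R.+ f 1 R.* g 0   ≈⟨ R.+-comm _ _ ⟩
      f 1 R.* g 0 R.+ (f 0 R.* g 1 R.+ R.0#)   ∎
      where open ≈-Reasoning
    ⊛-sucʳ f g (suc n) = begin
      p R.+ (tail f ⊛ g) (suc n)            ≈⟨ R.+-congˡ (⊛-sucʳ (tail f) g n) ⟩
      p R.+ (q R.+ (tail f ⊛ tail g) n)     ≈⟨ R.+-assoc _ _ _ ⟨
      p R.+ q R.+ (tail f ⊛ tail g) n       ≈⟨ R.+-congʳ (R.+-comm p q) ⟩
      q R.+ p R.+ (tail f ⊛ tail g) n       ≈⟨ R.+-assoc _ _ _ ⟩
      q R.+ (p R.+ (tail f ⊛ tail g) n)     ∎
      where
      open ≈-Reasoning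
      p = f 0 R.* g (suc (suc n))
      q = f (suc (suc n)) R.* g 0

    ⊛-comm : ∀ f g → f ⊛ g ≋ g ⊛ f
    ⊛-comm f g zero    = R.+-congʳ (R.*-comm _ _)
    ⊛-comm f g (suc n) = R.trans
      (R.+-cong (R.*-comm _ _) (⊛-comm (tail f) g n))
      (R.sym (⊛-sucʳ g f n))

    ⊛-distribʳ : ∀ f g h → (g ⊕ h) ⊛ f ≋ g ⊛ f ⊕ h ⊛ f
    ⊛-distribʳ f g h n = begin
      ((g ⊕ h) ⊛ f) n       ≈⟨ ⊛-comm (g ⊕ h) f n ⟩
      (f ⊛ (g ⊕ h)) n       ≈⟨ ⊛-distribˡ f g h n ⟩
      (f ⊛ g ⊕ f ⊛ h) n     ≈⟨ R.+-cong (⊛-comm f g n) (⊛-comm f h n) ⟩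
      (g ⊛ f ⊕ h ⊛ f) n     ∎
      where open ≈-Reasoning

    -- Induction on the degree for all `f` at once: the tail of `f ⊛ g` is by computation
    -- `scale (f 0) (tail g) ⊕ tail f ⊛ g`, so distributivity reduces the claim to `tail f`.
    ⊛-assoc : ∀ f g h → (f ⊛ g) ⊛ h ≋ f ⊛ (g ⊛ h)
    ⊛-assoc f g h zero = begin
      (f 0 R.* g 0 R.+ R.0#) R.* h 0 R.+ R.0#   ≈⟨ R.+-congʳ (R.*-congʳ (R.+-identityʳ _)) ⟩
      f 0 R.* g 0 R.* h 0 R.+ R.0#              ≈⟨ R.+-congʳ (R.*-assoc _ _ _) ⟩
      f 0 R.* (g 0 R.* h 0) R.+ R.0#            ≈⟨ R.+-congʳ (R.*-congˡ (R.+-identityʳ _)) ⟨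
      f 0 R.* (g 0 R.* h 0 R.+ R.0#) R.+ R.0#   ∎
      where open ≈-Reasoning
    ⊛-assoc f g h (suc n) = begin
      (f 0 R.* g 0 R.+ R.0#) R.* h (suc n) R.+ ((scale (f 0) (tail g) ⊕ tail f ⊛ g) ⊛ h) n
        ≈⟨ R.+-cong (R.*-congʳ (R.+-identityʳ _)) (⊛-distribʳ h (scale (f 0) (tail g)) (tail f ⊛ g) n) ⟩
      f 0 R.* g 0 R.* h (suc n) R.+ ((scale (f 0) (tail g) ⊛ h) n R.+ ((tail f ⊛ g) ⊛ h) n)
        ≈⟨ R.+-cong (R.*-assoc _ _ _) (R.+-cong (scale-⊛ (f 0) (tail g) h n) (⊛-assoc (tail f) g h n)) ⟩
      f 0 R.* (g 0 R.* h (suc n)) R.+ (f 0 R.* (tail g ⊛ h) n R.+ (tail f ⊛ (g ⊛ h)) n)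
        ≈⟨ R.+-assoc _ _ _ ⟨
      f 0 R.* (g 0 R.* h (suc n)) R.+ f 0 R.* (tail g ⊛ h) n R.+ (tail f ⊛ (g ⊛ h)) n
        ≈⟨ R.+-congʳ (R.distribˡ _ _ _) ⟨
      f 0 R.* (g 0 R.* h (suc n) R.+ (tail g ⊛ h) n) R.+ (tail f ⊛ (g ⊛ h)) n
        ∎
      where open ≈-Reasoning

  commutativeRing : CommutativeRing c ℓ
  commutativeRing = record
    { Carrier = Series
    ; _≈_     = _≋_
    ; _+_     = _⊕_
    ; _*_     = _⊛_
    ; -_      = λ f n → R.- f n
    ; 0#      = λ _ → R.0#
    ; 1#      = one
    ; isCommutativeRing = record
      { isRing = record
        { +-isAbelianGroup = record
          { isGroup = record
            { isMonoid = record
              { isSemigroup = record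
                { isMagma = record
                  { isEquivalence = record
                    { refl  = λ _ → R.refl
                    ; sym   = λ p n → R.sym (p n)
                    ; trans = λ p q n → R.trans (p n) (q n)
                    }
                  ; ∙-cong = λ p q n → R.+-cong (p n) (q n)
                  }
                ; assoc = λ f g h n → R.+-assoc (f n) (g n) (h n)
                }
              ; identity = (λ f n → R.+-identityˡ (f n)) , (λ f n → R.+-identityʳ (f n))
              }
            ; inverse = (λ f n → R.-‿inverseˡ (f n)) , (λ f n → R.-‿inverseʳ (f n))
            ; ⁻¹-cong = λ p n → R.-‿cong (p n)
            }
          ; comm = λ f g n → R.+-comm (f n) (g n)
          }
        ; *-cong     = ⊛-cong
        ; *-assoc    = ⊛-assoc
        ; *-identity = one-⊛ , (λ f n → R.trans (⊛-comm f one n) (one-⊛ f n))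
        ; distrib    = ⊛-distribˡ , ⊛-distribʳ
        }
      ; *-comm = ⊛-comm
      }
    }

-- The ring of series in x and y as an iterated power series ring.

open import Defs

module ℤ[[y]] = CommutativeRing (Univariate.commutativeRing ℤ.+-*-commutativeRing)
module ℤ[[y]][[x]] =
  CommutativeRing (Univariate.commutativeRing (Univariate.commutativeRing ℤ.+-*-commutativeRing))

open Algebra.Definitions.RawMonoid ℤ.+-0-rawMonoid using () renaming (sum to ∑ℤ)

sum-at : ∀ n (f : Fin n → PowerSeries) i j → sum {n} f i j ≡ ∑ℤ {n} (λ k → f k i j)
sum-at zero    f i j = ≡.refl
sum-at (suc n) f i j = ≡.cong (ℤ._+_ (f Fin.zero i j)) (sum-at n (λ k → f (Fin.suc k)) i j)

-- Both rings have the same coefficient functions as elements, and only the formulas for product and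
-- unit differ. These agree coefficientwise, so the ring laws carry over along the identity map.
isRingMonomorphism : IsRingMonomorphism powerSeriesRing ℤ[[y]][[x]].rawRing (λ f → f)
isRingMonomorphism = record
  { isRingHomomorphism = record
    { isSemiringHomomorphism = record
      { isNearSemiringHomomorphism = record
        { +-isMonoidHomomorphism = record
          { isMagmaHomomorphism = record
            { isRelHomomorphism = record { cong = λ p → p }
            ; homo = λ f g i j → ≡.refl
            }
          ; ε-homo = λ i j → ≡.refl
          }
        ; *-homo = λ f g i j → ≡.sym (∑-pointwise (suc i) (λ a → f (toℕ a) ℤ[[y]].* g (i ∸ toℕ a)) j)
        }
      ; 1#-homo = λ { zero zero → ≡.refl ; zero (suc j) → ≡.refl ; (suc i) j → ≡.refl }
      }
    ; -‿homo = λ f i j → ≡.refl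
    }
  ; injective = λ p → p
  }
  where
  open Algebra.Definitions.RawMonoid ℤ[[y]].+-rawMonoid using () renaming (sum to ∑ℤ[[y]])
  ∑-pointwise : ∀ n (f : Fin n → ℕ → ℤ) j → ∑ℤ[[y]] {n} f j ≡ ∑ℤ {n} (λ k → f k j)
  ∑-pointwise zero    f j = ≡.refl
  ∑-pointwise (suc n) f j = ≡.cong (ℤ._+_ (f Fin.zero j)) (∑-pointwise n (λ k → f (Fin.suc k)) j)

commutativeRing : CommutativeRing _ _
commutativeRing = record
  { isCommutativeRing =
      Algebra.Morphism.RingMonomorphism.isCommutativeRing isRingMonomorphism
        ℤ[[y]][[x]].isCommutativeRing
  }

module PS = CommutativeRing commutativeRing
module PS-Reasoning = Relation.Binary.Reasoning.Setoid PS.setoid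

open Algebra.Properties.CommutativeSemigroup PS.*-commutativeSemigroup using (interchange; x∙yz≈y∙xz)
open Algebra.Properties.Monoid.Sum ℤ.+-0-monoid using () renaming (sum-cong-≗ to ∑ℤ-cong)
open Algebra.Properties.Semiring.Exp PS.semiring using (^-congʳ; ^-homo-*)
open MonoidLemmas PS.+-monoid using () renaming (sum-toℕ-last to sum-last)
open MonoidLemmas PS.*-monoid using () renaming (sum-toℕ-last to product-last)
open RingLemmas commutativeRing

-- Coefficients of products with x and y.

x*-zero : ∀ f j → (x * f) zero j ≡ 0ℤ
x*-zero f j = ≡.trans (ℤ.+-identityʳ _) (ℤ[[y]].zeroˡ (f 0) j)

x*-suc : ∀ f i j → (x * f) (suc i) j ≡ f i j
x*-suc f i j = ≡.trans
  (≡.cong₂ ℤ._+_ (ℤ[[y]].zeroˡ (f (suc i)) j) (PS.*-identityˡ f i j))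
  (ℤ.+-identityˡ _)

y*-row : ∀ f i j → (y * f) i j ≡ (y 0 ℤ[[y]].* f i) j
y*-row f zero    j = ℤ.+-identityʳ _
y*-row f (suc i) j = ≡.trans
  (≡.cong (ℤ._+_ ((y 0 ℤ[[y]].* f (suc i)) j)) (PS.zeroˡ f i j))
  (ℤ.+-identityʳ _)

y*-zero : ∀ f i → (y * f) i zero ≡ 0ℤ
y*-zero f i = y*-row f i zero

y*-suc : ∀ f i j → (y * f) i (suc j) ≡ f i j
y*-suc f i j = ≡.trans (y*-row f i (suc j)) (≡.trans (ℤ.+-identityˡ _)
  (≡.trans
    (ℤ[[y]].*-congʳ {f i} {λ b → y 0 (suc b)} {ℤ[[y]].1#} (λ { zero → ≡.refl ; (suc _) → ≡.refl }) j)
    (ℤ[[y]].*-identityˡ (f i) j)))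

*-local : ∀ h {g g′} i → (∀ l → l ℕ.≤ i → ∀ j → g l j ≡ g′ l j) → ∀ j → (h * g) i j ≡ (h * g′) i j
*-local h i g≡g′ j = ∑ℤ-cong {suc i} λ a → ∑ℤ-cong {suc j} λ b →
  ≡.cong (h (toℕ a) (toℕ b) ℤ.*_) (g≡g′ (i ∸ toℕ a) (ℕ.m∸n≤m i (toℕ a)) (j ∸ toℕ b))

x^n*-zero : ∀ n f i j → i ℕ.< n → (x ^ n * f) i j ≡ 0ℤ
x^n*-zero (suc n) f zero    j _ = ≡.trans (PS.*-assoc x (x ^ n) f 0 j) (x*-zero (x ^ n * f) j)
x^n*-zero (suc n) f (suc i) j (ℕ.s≤s i<n) = ≡.trans (PS.*-assoc x (x ^ n) f (suc i) j)
  (≡.trans (x*-suc (x ^ n * f) i j) (x^n*-zero n f i j i<n))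

-- The inverse of 1 - x h is the fixed point of g ↦ 1 + x (h g); iterating m times from 0 gives its
-- coefficients at xⁱ for all i < m.
module _ (h : PowerSeries) where

  private
    approximation : ℕ → PowerSeries
    approximation zero    = 0#
    approximation (suc m) = 1# + x * (h * approximation m)

    approximation-stable : ∀ m i → i ℕ.< m → ∀ j → approximation m i j ≡ approximation (suc m) i j
    approximation-stable (suc m) zero    _           j =
      ≡.cong (ℤ._+_ (1# 0 j)) (≡.trans (x*-zero (h * approximation m) j) (≡.sym (x*-zero (h * approximation (suc m)) j)))
    approximation-stable (suc m) (suc i) (ℕ.s≤s i<m) j =
      ≡.cong (ℤ._+_ (1# (suc i) j)) (begin
        (x * (h * approximation m)) (suc i) j          ≡⟨ x*-suc (h * approximation m) i j ⟩
        (h * approximation m) i j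
          ≡⟨ *-local h i (λ l l≤i → approximation-stable m l (ℕ.≤-<-trans l≤i i<m)) j ⟩
        (h * approximation (suc m)) i j                ≡⟨ x*-suc (h * approximation (suc m)) i j ⟨
        (x * (h * approximation (suc m))) (suc i) j    ∎)
      where open ≡.≡-Reasoning

  geometric : PowerSeries
  geometric i = approximation (suc i) i

  private
    geometric≡approximation : ∀ {m i} → i ℕ.<′ m → ∀ j → geometric i j ≡ approximation m i j
    geometric≡approximation ℕ.≤′-refl j = ≡.refl
    geometric≡approximation {suc m} {i} (ℕ.≤′-step i<m) j = ≡.trans
      (geometric≡approximation i<m j) (approximation-stable m i (ℕ.≤′⇒≤ i<m) j)

  geometric-unfold : geometric ≈ 1# + x * (h * geometric)
  geometric-unfold zero    j =
    ≡.cong (ℤ._+_ (1# 0 j)) (≡.trans (x*-zero (h * 0#) j) (≡.sym (x*-zero (h * geometric) j)))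
  geometric-unfold (suc i) j = ≡.cong (ℤ._+_ (1# (suc i) j)) (begin
    (x * (h * approximation (suc i))) (suc i) j   ≡⟨ x*-suc (h * approximation (suc i)) i j ⟩
    (h * approximation (suc i)) i j
      ≡⟨ *-local h i (λ l l≤i j → ≡.sym (geometric≡approximation (ℕ.≤⇒≤′ (ℕ.s≤s l≤i)) j)) j ⟩
    (h * geometric) i j                           ≡⟨ x*-suc (h * geometric) i j ⟨
    (x * (h * geometric)) (suc i) j               ∎)
    where open ≡.≡-Reasoning

-- The denominators and their inverses.

u w : PowerSeries
u = x * y
w = 1# + u

factor factor⁻¹ : ℕ → PowerSeries
factor k = 1# - w ^ k * u
factor⁻¹ k = geometric (w ^ k * y)

-- Moving the x of `u` to the front, `w ^ k * u` becomes `x * (w ^ k * y)`, so `factor k` has the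
-- form 1 - x h that `geometric` inverts.
factor-inverse : ∀ k → factor⁻¹ k * factor k ≈ 1#
factor-inverse k = f≈g+rf⇒f[1-r]≈g {w ^ k * u} {factor⁻¹ k} {1#} (PS.trans
  (geometric-unfold (w ^ k * y))
  (PS.+-congˡ {1#} {x * (w ^ k * y * factor⁻¹ k)} {w ^ k * u * factor⁻¹ k} (PS.trans
    (PS.sym (PS.*-assoc x (w ^ k * y) (factor⁻¹ k)))
    (PS.*-congʳ {factor⁻¹ k} {x * (w ^ k * y)} {w ^ k * u} (x∙yz≈y∙xz x (w ^ k) y)))))

-- The generating function of continuations

-- The number of ways to continue by m further elements and k further arcs, when a + 1 blocks have
-- been started and s of them, not counting that of the previous element, may receive the next one.
choices : (a s m k : ℕ) → ℕ
count : (a s m k : ℕ) → ℕ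
count a s zero    zero    = 1
count a s zero    (suc k) = 0
count a s (suc m) zero    = count (suc a) (suc a) m zero
count a s (suc m) (suc k) =
  count (suc a) (suc a) m (suc k) ℕ.+ (count a a m k ℕ.+ choices a s m k)
choices a zero    m k = 0
-- Joining an admissible block leaves only the admissible ones behind it, so over all choices the
-- number left takes each of the values s, s - 1, ..., 0 once.
choices a (suc s) m k = count a s m k ℕ.+ choices a s m k

-- Each further element closes at most one arc. This matches the upper limit n - 1 of the inner sum
-- in the theorem.
count-zero : ∀ a s {m k} → m ℕ.< k → count a s m k ≡ 0
choices-zero : ∀ a s {m k} → m ℕ.< k → choices a s m k ≡ 0
count-zero a s {zero}  {suc k} _           = ≡.refl
count-zero a s {suc m} {suc k} (ℕ.s≤s m<k) = ≡.cong₂ ℕ._+_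
  (count-zero (suc a) (suc a) (ℕ.m<n⇒m<1+n m<k))
  (≡.cong₂ ℕ._+_ (count-zero a a m<k) (choices-zero a s m<k))
choices-zero a zero    m<k = ≡.refl
choices-zero a (suc s) m<k = ≡.cong₂ ℕ._+_ (count-zero a s m<k) (choices-zero a s m<k)

Φ : (a s : ℕ) → PowerSeries
Φ a s m k = ℤ.+ count a s m k

u*-zeroˡ : ∀ f j → (u * f) zero j ≡ 0ℤ
u*-zeroˡ f j = ≡.trans (PS.*-assoc x y f 0 j) (x*-zero (y * f) j)

u*-zeroʳ : ∀ f i → (u * f) i zero ≡ 0ℤ
u*-zeroʳ f zero    = u*-zeroˡ f zero
u*-zeroʳ f (suc i) = ≡.trans (PS.*-assoc x y f (suc i) 0)
  (≡.trans (x*-suc (y * f) i 0) (y*-zero f i))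

u*-suc : ∀ f i j → (u * f) (suc i) (suc j) ≡ f i j
u*-suc f i j = ≡.trans (PS.*-assoc x y f (suc i) (suc j))
  (≡.trans (x*-suc (y * f) i (suc j)) (y*-suc f i j))

Φ-zero : ∀ a → Φ a 0 ≈ 1# + x * Φ (suc a) (suc a) + u * Φ a a
Φ-zero a zero zero = ≡.sym (≡.cong₂ ℤ._+_
  (≡.cong (ℤ._+_ 1ℤ) (x*-zero (Φ (suc a) (suc a)) 0)) (u*-zeroˡ (Φ a a) 0))
Φ-zero a zero (suc k) = ≡.sym (≡.cong₂ ℤ._+_
  (≡.cong (ℤ._+_ 0ℤ) (x*-zero (Φ (suc a) (suc a)) (suc k))) (u*-zeroˡ (Φ a a) (suc k)))
Φ-zero a (suc m) zero = ≡.sym (≡.trans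
  (≡.cong₂ ℤ._+_ (≡.cong (ℤ._+_ 0ℤ) (x*-suc (Φ (suc a) (suc a)) m 0)) (u*-zeroʳ (Φ a a) (suc m)))
  (≡.cong ℤ.+_ (ℕ.+-identityʳ _)))
Φ-zero a (suc m) (suc k) = ≡.sym (≡.trans
  (≡.cong₂ ℤ._+_ (≡.cong (ℤ._+_ 0ℤ) (x*-suc (Φ (suc a) (suc a)) m (suc k))) (u*-suc (Φ a a) m k))
  (≡.cong (λ n → ℤ.+ (count (suc a) (suc a) m (suc k) ℕ.+ n)) (≡.sym (ℕ.+-identityʳ _))))

-- `choices a (suc s)` exceeds `choices a s` by `count a s`: one more admissible block adds exactly
-- the continuations that begin by joining it, and that step contributes the factor `u`.
Φ-suc : ∀ a s → Φ a (suc s) ≈ w * Φ a s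
Φ-suc a s = PS.trans lemma (PS.trans
  (PS.+-congʳ {u * Φ a s} {Φ a s} {1# * Φ a s} (PS.sym (PS.*-identityˡ (Φ a s))))
  (PS.sym (PS.distribʳ (Φ a s) 1# u)))
  where
  lemma : Φ a (suc s) ≈ Φ a s + u * Φ a s
  lemma zero    zero    = ≡.sym (≡.cong (ℤ._+_ 1ℤ) (u*-zeroˡ (Φ a s) 0))
  lemma zero    (suc k) = ≡.sym (≡.cong (ℤ._+_ 0ℤ) (u*-zeroˡ (Φ a s) (suc k)))
  lemma (suc m) zero    = ≡.sym (≡.trans
    (≡.cong (ℤ._+_ (Φ a s (suc m) 0)) (u*-zeroʳ (Φ a s) (suc m)))
    (ℤ.+-identityʳ _))
  lemma (suc m) (suc k) = ≡.trans (≡.cong ℤ.+_ (begin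
    new ℕ.+ (last ℕ.+ (pick ℕ.+ picks))   ≡⟨ ≡.cong (λ n → new ℕ.+ (last ℕ.+ n)) (ℕ.+-comm pick picks) ⟩
    new ℕ.+ (last ℕ.+ (picks ℕ.+ pick))   ≡⟨ ≡.cong (ℕ._+_ new) (ℕ.+-assoc last picks pick) ⟨
    new ℕ.+ (last ℕ.+ picks ℕ.+ pick)     ≡⟨ ℕ.+-assoc new _ pick ⟨
    new ℕ.+ (last ℕ.+ picks) ℕ.+ pick     ∎))
    (≡.sym (≡.cong (ℤ._+_ (Φ a s (suc m) (suc k))) (u*-suc (Φ a s) m k)))
    where
    open ≡.≡-Reasoning
    new   = count (suc a) (suc a) m (suc k)
    last  = count a a m k
    pick  = count a s m k
    picks = choices a s m k

Φ-power : ∀ a s → Φ a s ≈ w ^ s * Φ a 0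
Φ-power a zero    = PS.sym (PS.*-identityˡ (Φ a 0))
Φ-power a (suc s) = PS.trans (Φ-suc a s) (PS.trans
  (PS.*-congˡ {w} {Φ a s} {w ^ s * Φ a 0} (Φ-power a s))
  (PS.sym (PS.*-assoc w (w ^ s) (Φ a 0))))

-- `Φ-power` expresses both series on the right of `Φ-zero` by values at `s = 0`, which leaves a
-- linear equation for `Φ a 0`.
Φ*factor : ∀ a → Φ a 0 * factor a ≈ 1# + x * w ^ suc a * Φ (suc a) 0
Φ*factor a = f≈g+rf⇒f[1-r]≈g {w ^ a * u} {Φ a 0} {1# + x * w ^ suc a * Φ (suc a) 0}
  (PS.trans (Φ-zero a) (PS.+-cong
    {1# + x * Φ (suc a) (suc a)} {1# + x * w ^ suc a * Φ (suc a) 0} {u * Φ a a} {w ^ a * u * Φ a 0}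
    (PS.+-congˡ {1#} {x * Φ (suc a) (suc a)} {x * w ^ suc a * Φ (suc a) 0} (PS.trans
      (PS.*-congˡ {x} {Φ (suc a) (suc a)} {w ^ suc a * Φ (suc a) 0} (Φ-power (suc a) (suc a)))
      (PS.sym (PS.*-assoc x (w ^ suc a) (Φ (suc a) 0)))))
    (PS.trans
      (PS.*-congˡ {u} {Φ a a} {w ^ a * Φ a 0} (Φ-power a a))
      (PS.trans (PS.sym (PS.*-assoc u (w ^ a) (Φ a 0)))
        (PS.*-congʳ {Φ a 0} {u * w ^ a} {w ^ a * u} (PS.*-comm u (w ^ a)))))))

-- Telescoping the recursion.

-- `remainder m` is what is left of `x * Φ 0 0` after the terms 1, ..., m. It already carries the
-- numerator of the next term; the missing denominator factor is hidden in `Φ m 0`.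
numerator denominator denominator⁻¹ term remainder : ℕ → PowerSeries
numerator n = x ^ n * w ^ (n C 2)
denominator n = product {n} λ k → factor (toℕ k)
denominator⁻¹ n = product {n} λ k → factor⁻¹ (toℕ k)
term n = numerator n * denominator⁻¹ n
remainder m = numerator (suc m) * denominator⁻¹ m * Φ m 0

numerator-suc : ∀ n → numerator (suc n) ≈ numerator n * (x * w ^ n)
numerator-suc n = begin
  x * x ^ n * w ^ (suc n C 2)             ≈⟨ PS.*-cong {x * x ^ n} {x ^ n * x} (PS.*-comm x (x ^ n))
                                               (PS.trans
                                                 (^-congʳ w exponent)
                                                 (^-homo-* w (n C 2) n)) ⟩
  x ^ n * x * (w ^ (n C 2) * w ^ n)       ≈⟨ interchange (x ^ n) x (w ^ (n C 2)) (w ^ n) ⟩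
  x ^ n * w ^ (n C 2) * (x * w ^ n)       ∎
  where
  open PS-Reasoning
  exponent : suc n C 2 ≡ n C 2 ℕ.+ n
  exponent = ≡.trans (≡.sym (nCk+nC[k+1]≡[n+1]C[k+1] n 1))
    (≡.trans (ℕ.+-comm (n C 1) (n C 2)) (≡.cong (ℕ._+_ (n C 2)) (nC1≡n n)))

remainder-step : ∀ m → remainder m ≈ term (suc m) + remainder (suc m)
remainder-step m = begin
  numerator (suc m) * denominator⁻¹ m * Φ m 0
    ≈⟨ divide-step {Φ m 0} {factor m} {factor⁻¹ m} {x * w ^ suc m} {Φ (suc m) 0}
         (numerator (suc m)) (denominator⁻¹ m) (Φ*factor m)
         (PS.trans (PS.*-comm (factor m) (factor⁻¹ m)) (factor-inverse m)) ⟩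
  numerator (suc m) * D + numerator (suc m) * (x * w ^ suc m) * D * Φ (suc m) 0
    ≈⟨ PS.+-cong {numerator (suc m) * D} {term (suc m)}
         (PS.*-congˡ {numerator (suc m)} {D} {denominator⁻¹ (suc m)} D≈)
         (PS.*-congʳ {Φ (suc m) 0} {numerator (suc m) * (x * w ^ suc m) * D}
           (PS.*-cong {numerator (suc m) * (x * w ^ suc m)} {numerator (suc (suc m))} {D}
             (PS.sym (numerator-suc (suc m))) D≈)) ⟩
  term (suc m) + remainder (suc m)
    ∎
  where
  open PS-Reasoning
  D = denominator⁻¹ m * factor⁻¹ m
  D≈ : D ≈ denominator⁻¹ (suc m)
  D≈ = PS.sym (product-last factor⁻¹ m)

telescope : ∀ m → x * Φ 0 0 ≈ sum {m} (λ k → term (suc (toℕ k))) + remainder m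
telescope zero = begin
  x * Φ 0 0                          ≈⟨ PS.*-congʳ {Φ 0 0} {remainder-coefficient} {x} coefficient≈x ⟨
  remainder-coefficient * Φ 0 0      ≈⟨ PS.+-identityˡ (remainder 0) ⟨
  0# + remainder 0                   ∎
  where
  open PS-Reasoning
  remainder-coefficient = numerator 1 * denominator⁻¹ 0
  coefficient≈x : remainder-coefficient ≈ x
  coefficient≈x = PS.trans (PS.*-identityʳ (numerator 1))
    (PS.trans (PS.*-identityʳ (x ^ 1)) (PS.*-identityʳ x))
telescope (suc m) = begin
  x * Φ 0 0                                         ≈⟨ telescope m ⟩
  ∑term + remainder m                               ≈⟨ PS.+-congˡ {∑term} {remainder m} (remainder-step m) ⟩
  ∑term + (term (suc m) + remainder (suc m))        ≈⟨ PS.+-assoc ∑term (term (suc m)) (remainder (suc m)) ⟨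
  ∑term + term (suc m) + remainder (suc m)
    ≈⟨ PS.+-congʳ {remainder (suc m)} {sum {suc m} (λ k → term (suc (toℕ k)))} {∑term + term (suc m)}
         (sum-last (λ k → term (suc k)) m) ⟨
  sum {suc m} (λ k → term (suc (toℕ k))) + remainder (suc m) ∎
  where
  open PS-Reasoning
  ∑term = sum {m} (λ k → term (suc (toℕ k)))

-- The numerator contains `x ^ suc m`. Hence the first m terms settle all coefficients up to
-- x-degree m, which is the convergence of the sum.
remainder-zero : ∀ m i j → i ℕ.≤ m → remainder m i j ≡ 0ℤ
remainder-zero m i j i≤m = ≡.trans
  (PS.trans
    (PS.*-assoc (numerator (suc m)) (denominator⁻¹ m) (Φ m 0))
    (PS.*-assoc (x ^ suc m) (w ^ (suc m C 2)) (denominator⁻¹ m * Φ m 0)) i j)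
  (x^n*-zero (suc m) (w ^ (suc m C 2) * (denominator⁻¹ m * Φ m 0)) i j (ℕ.s≤s i≤m))

term-hasSum : HasSum term (x * Φ 0 0)
term-hasSum i j = i , λ m i≤m → ≡.sym (≡.trans (telescope m i j)
  (≡.trans (≡.cong (ℤ._+_ (sum {m} (λ k → term (suc (toℕ k))) i j)) (remainder-zero m i j i≤m))
    (ℤ.+-identityʳ _)))

denominator-inverse : ∀ n → denominator⁻¹ n * denominator n ≈ 1#
denominator-inverse n = ∏-inverse n {λ k → factor⁻¹ (toℕ k)} {λ k → factor (toℕ k)} λ k → factor-inverse (toℕ k)

term-isQuotient : ∀ n → IsQuotient (term n) (numerator n) (denominator n)
term-isQuotient n =
    (denominator⁻¹ n , denominator-inverse n ,
      PS.trans (PS.*-comm (denominator n) (denominator⁻¹ n)) (denominator-inverse n))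
  , PS.trans (PS.*-assoc (numerator n) (denominator⁻¹ n) (denominator n))
      (PS.trans (PS.*-congˡ {numerator n} {denominator⁻¹ n * denominator n} {1#} (denominator-inverse n))
        (PS.*-identityʳ (numerator n)))

-- Sums of monomials with given coefficients.

monomial-x^y^ : ∀ n k → x ^ n * y ^ k ≈ monomial n k
monomial-x^y^ (suc n) k i j = ≡.trans (PS.*-assoc x (x ^ n) (y ^ k) i j) (lemma i)
  where
  lemma : ∀ i → (x * (x ^ n * y ^ k)) i j ≡ monomial (suc n) k i j
  lemma zero    = x*-zero (x ^ n * y ^ k) j
  lemma (suc i) = ≡.trans (x*-suc (x ^ n * y ^ k) i j) (monomial-x^y^ n k i j)
monomial-x^y^ zero k i j = ≡.trans (PS.*-identityˡ (y ^ k) i j) (lemma k i j)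
  where
  lemma : ∀ k i j → (y ^ k) i j ≡ monomial 0 k i j
  lemma zero    i j = ≡.refl
  lemma (suc k) zero    zero    = y*-zero (y ^ k) zero
  lemma (suc k) (suc i) zero    = y*-zero (y ^ k) (suc i)
  lemma (suc k) zero    (suc j) = ≡.trans (y*-suc (y ^ k) zero j) (lemma k zero j)
  lemma (suc k) (suc i) (suc j) = ≡.trans (y*-suc (y ^ k) (suc i) j) (lemma k (suc i) j)

·-at : ∀ n f i j → (n · f) i j ≡ ℤ.+ n ℤ.* f i j
·-at zero    f i j = ≡.refl
·-at (suc n) f i j = ≡.trans (≡.cong (ℤ._+_ (f i j)) (·-at n f i j))
  (≡.sym (ℤ.suc-* (ℤ.+ n) (f i j)))

monomial-diagonal : ∀ a b → monomial a b a b ≡ 1ℤ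
monomial-diagonal zero    zero    = ≡.refl
monomial-diagonal zero    (suc b) = monomial-diagonal zero b
monomial-diagonal (suc a) b       = monomial-diagonal a b

monomial-≢ˡ : ∀ {a i} b j → a ≢ i → monomial a b i j ≡ 0ℤ
monomial-≢ˡ {zero}  {zero}  b j a≢i = contradiction ≡.refl a≢i
monomial-≢ˡ {zero}  {suc i} b j a≢i = ≡.refl
monomial-≢ˡ {suc a} {zero}  b j a≢i = ≡.refl
monomial-≢ˡ {suc a} {suc i} b j a≢i = monomial-≢ˡ b j (a≢i ∘ ≡.cong suc)

monomial-≢ʳ : ∀ a {b} i {j} → b ≢ j → monomial a b i j ≡ 0ℤ
monomial-≢ʳ zero    {b} (suc i) b≢j = ≡.refl
monomial-≢ʳ (suc a) {b} zero    b≢j = ≡.refl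
monomial-≢ʳ (suc a) {b} (suc i) b≢j = monomial-≢ʳ a i b≢j
monomial-≢ʳ zero    {zero}  zero {zero}  b≢j = contradiction ≡.refl b≢j
monomial-≢ʳ zero    {zero}  zero {suc j} b≢j = ≡.refl
monomial-≢ʳ zero    {suc b} zero {zero}  b≢j = ≡.refl
monomial-≢ʳ zero    {suc b} zero {suc j} b≢j = monomial-≢ʳ zero zero (b≢j ∘ ≡.cong suc)

∑-zero : ∀ n {f : Fin n → ℤ} → (∀ k → f k ≡ 0ℤ) → ∑ℤ f ≡ 0ℤ
∑-zero zero    f≡0 = ≡.refl
∑-zero (suc n) f≡0 = ≡.cong₂ ℤ._+_ (f≡0 Fin.zero) (∑-zero n λ k → f≡0 (Fin.suc k))

∑-single : ∀ n (f : Fin n → ℤ) {l v} → l ℕ.< n → (∀ k → toℕ k ≡ l → f k ≡ v) →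
           (∀ k → toℕ k ≢ l → f k ≡ 0ℤ) → ∑ℤ f ≡ v
∑-single (suc n) f {zero}  _ f≡v f≡0 = ≡.trans
  (≡.cong₂ ℤ._+_ (f≡v Fin.zero ≡.refl) (∑-zero n λ k → f≡0 (Fin.suc k) λ ()))
  (ℤ.+-identityʳ _)
∑-single (suc n) f {suc l} (ℕ.s≤s l<n) f≡v f≡0 = ≡.trans
  (≡.cong₂ ℤ._+_ (f≡0 Fin.zero λ ())
    (∑-single n (λ k → f (Fin.suc k)) l<n (λ k k≡l → f≡v (Fin.suc k) (≡.cong suc k≡l))
      (λ k k≢l → f≡0 (Fin.suc k) (k≢l ∘ ℕ.suc-injective))))
  (ℤ.+-identityˡ _)

module _ (c : ℕ → ℕ → ℕ) where

  private
    coefficients : ℕ → PowerSeries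
    coefficients n = sum {n} λ k → c n (toℕ k) · (x ^ n * y ^ toℕ k)

    summand : ∀ n k i j → (c n k · (x ^ n * y ^ k)) i j ≡ ℤ.+ c n k ℤ.* monomial n k i j
    summand n k i j = ≡.trans (·-at (c n k) (x ^ n * y ^ k) i j)
      (≡.cong (ℤ.+ c n k ℤ.*_) (monomial-x^y^ n k i j))

    summand-≢ : ∀ n k i j → monomial n k i j ≡ 0ℤ → (c n k · (x ^ n * y ^ k)) i j ≡ 0ℤ
    summand-≢ n k i j m≡0 = ≡.trans (summand n k i j)
      (≡.trans (≡.cong (ℤ.+ c n k ℤ.*_) m≡0) (ℤ.*-zeroʳ (ℤ.+ c n k)))

    coefficients-≢ : ∀ n i j → n ≢ i → coefficients n i j ≡ 0ℤ
    coefficients-≢ n i j n≢i = ≡.trans (sum-at n _ i j)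
      (∑-zero n λ k → summand-≢ n (toℕ k) i j (monomial-≢ˡ (toℕ k) j n≢i))

    coefficients-< : ∀ n j → j ℕ.< n → coefficients n n j ≡ ℤ.+ c n j
    coefficients-< n j j<n = ≡.trans (sum-at n _ n j) (∑-single n _ j<n
      (λ { k ≡.refl → ≡.trans (summand n (toℕ k) n (toℕ k)) (≡.trans
             (≡.cong (ℤ.+ c n (toℕ k) ℤ.*_) (monomial-diagonal n (toℕ k))) (ℤ.*-identityʳ _)) })
      (λ k k≢j → summand-≢ n (toℕ k) n j (monomial-≢ʳ n n k≢j)))

    coefficients-≥ : ∀ n j → n ℕ.≤ j → coefficients n n j ≡ 0ℤ
    coefficients-≥ n j n≤j = ≡.trans (sum-at n _ n j)
      (∑-zero n λ k → summand-≢ n (toℕ k) n j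
        (monomial-≢ʳ n n (ℕ.<⇒≢ (ℕ.<-≤-trans (Fin.toℕ<n k) n≤j))))

  -- The summand of index n lives in x-degree n alone, so a coefficient of the partial sums is
  -- constant once that index has been reached. The hypotheses on `s` distinguish whether the
  -- y-degree lies within the range of the inner sum.
  coefficients-hasSum : ∀ {s} → (∀ j → s 0 j ≡ 0ℤ) → (∀ n j → j ℕ.≤ n → s (suc n) j ≡ ℤ.+ c (suc n) j) →
                        (∀ n j → n ℕ.< j → s (suc n) j ≡ 0ℤ) →
                        HasSum coefficients s
  coefficients-hasSum s₀ s≤ s> zero j = 0 , λ m _ → ≡.trans (sum-at m _ 0 j)
    (≡.trans (∑-zero m λ n → coefficients-≢ (suc (toℕ n)) 0 j λ ()) (≡.sym (s₀ j)))
  coefficients-hasSum {s} s₀ s≤ s> (suc i) j = suc i , λ m i<m → ≡.trans (sum-at m _ (suc i) j)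
    (∑-single m _ i<m
      (λ { k ≡.refl → row (toℕ k) (ℕ.≤-<-connex j (toℕ k)) })
      (λ k k≢i → coefficients-≢ (suc (toℕ k)) (suc i) j (k≢i ∘ ℕ.suc-injective)))
    where
    row : ∀ n → j ℕ.≤ n ⊎ n ℕ.< j → coefficients (suc n) (suc n) j ≡ s (suc n) j
    row n (inj₁ j≤n) = ≡.trans (coefficients-< (suc n) j (ℕ.s≤s j≤n)) (≡.sym (s≤ n j j≤n))
    row n (inj₂ n<j) = ≡.trans (coefficients-≥ (suc n) j n<j) (≡.sym (s> n j n<j))

-- Arc diagrams

Arc : Set
Arc = ℕ × ℕ

-- Arcs are listed by increasing right end, so that a set of arcs has only one list. Distinct right
-- ends and distinct left ends let every element have at most one arc on either side, as in a set
-- partition. In this order only the earlier arc can be the first one of a right crossing.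
Compatible : Arc → Arc → Set
Compatible (i₁ , j₁) (i₂ , j₂) =
  j₁ < j₂ × i₁ ≢ i₂ × ¬ (i₁ < i₂ × i₂ < j₁ × j₂ ≡ suc j₁)

-- The ways to add k arcs to a partition of {0, …, t} on adding t + 1, …, t + m. The greatest elements
-- of the blocks are t ∷ S ++ V, in descending order, and the next element may be joined to t or to
-- an element of V: if t has been joined to i, then V consists of those less than i, since joining t + 1
-- to one between i and t is a right crossing; otherwise S is empty.
diagrams picks : (m k t : ℕ) (S V : List ℕ) → List (List Arc)
diagrams zero    zero    t S V = [] ∷ []
diagrams zero    (suc k) t S V = []
diagrams (suc m) zero    t S V = diagrams m zero (suc t) [] (t ∷ S ++ V)
diagrams (suc m) (suc k) t S V =
  diagrams m (suc k) (suc t) [] (t ∷ S ++ V) ++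
  map ((t , suc t) ∷_) (diagrams m k (suc t) [] (S ++ V)) ++
  picks m k t S V
picks m k t S []      = []
picks m k t S (i ∷ V) =
  map ((i , suc t) ∷_) (diagrams m k (suc t) (t ∷ S) V) ++ picks m k t (S ∷ʳ i) V

-- The recursion depends on `S` and `V` only through their lengths. Since the block of `t` is listed
-- apart, the lengths add up to one less than the number of blocks.
length-diagrams : ∀ m k t S V → length (diagrams m k t S V) ≡ count (length S ℕ.+ length V) (length V) m k
length-picks : ∀ m k t S V → length (picks m k t S V) ≡ choices (length S ℕ.+ length V) (length V) m k
length-diagrams zero    zero    t S V = refl
length-diagrams zero    (suc k) t S V = refl
length-diagrams (suc m) zero    t S V = ≡.trans
  (length-diagrams m zero (suc t) [] (t ∷ S ++ V))
  (≡.cong (λ a → count (suc a) (suc a) m zero) (length-++ S))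
length-diagrams (suc m) (suc k) t S V = ≡.trans
  (length-++ (diagrams m (suc k) (suc t) [] (t ∷ S ++ V)))
  (≡.cong₂ ℕ._+_
    (≡.trans
      (length-diagrams m (suc k) (suc t) [] (t ∷ S ++ V))
      (≡.cong (λ a → count (suc a) (suc a) m (suc k)) (length-++ S)))
    (≡.trans
      (length-++ (map ((t , suc t) ∷_) (diagrams m k (suc t) [] (S ++ V))))
      (≡.cong₂ ℕ._+_
        (≡.trans
          (length-map _ (diagrams m k (suc t) [] (S ++ V)))
          (≡.trans
            (length-diagrams m k (suc t) [] (S ++ V))
            (≡.cong (λ a → count a a m k) (length-++ S))))
        (length-picks m k t S V))))
length-picks m k t S []      = refl
length-picks m k t S (i ∷ V) = ≡.trans
  (length-++ (map ((i , suc t) ∷_) (diagrams m k (suc t) (t ∷ S) V)))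
  (≡.cong₂ ℕ._+_
    (≡.trans
      (length-map _ (diagrams m k (suc t) (t ∷ S) V))
      (≡.trans
        (length-diagrams m k (suc t) (t ∷ S) V)
        (≡.cong (λ a → count a (length V) m k) (≡.sym (ℕ.+-suc (length S) (length V))))))
    (≡.trans
      (length-picks m k t (S ∷ʳ i) V)
      (≡.cong (λ a → choices a (length V) m k) lemma)))
  where
  lemma : length (S ∷ʳ i) ℕ.+ length V ≡ length S ℕ.+ suc (length V)
  lemma = ≡.trans (≡.sym (length-++ (S ∷ʳ i))) (≡.trans (≡.cong length (∷ʳ-++ S i V)) (length-++ S))

-- Elements passed over in `V` are appended to `S`, so when `i` is chosen, `S ++ V₁` consists of
-- everything listed between `t` and `i`.
∈-picks⁻ : ∀ m k t S V {A} → A ∈ picks m k t S V →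
           ∃[ V₁ ] ∃[ i ] ∃[ V₂ ] ∃[ A′ ]
             V ≡ V₁ ++ i ∷ V₂ × A ≡ (i , suc t) ∷ A′ × A′ ∈ diagrams m k (suc t) (t ∷ S ++ V₁) V₂
∈-picks⁻ m k t S (i ∷ V) A∈ with ∈-++⁻ (map ((i , suc t) ∷_) (diagrams m k (suc t) (t ∷ S) V)) A∈
... | inj₁ A∈map with A′ , A′∈ , refl ← ∈-map⁻ ((i , suc t) ∷_) A∈map =
  [] , i , V , A′ , refl , refl ,
  ≡.subst (λ S → A′ ∈ diagrams m k (suc t) (t ∷ S) V) (≡.sym (++-identityʳ S)) A′∈
... | inj₂ A∈picks with V₁ , i′ , V₂ , A′ , refl , refl , A′∈ ← ∈-picks⁻ m k t (S ∷ʳ i) V A∈picks =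
  i ∷ V₁ , i′ , V₂ , A′ , refl , refl ,
  ≡.subst (λ S → A′ ∈ diagrams m k (suc t) (t ∷ S) V₂) (∷ʳ-++ S i V₁) A′∈

∈-picks⁺ : ∀ m k t S V₁ {i V₂ A} → A ∈ diagrams m k (suc t) (t ∷ S ++ V₁) V₂ →
           (i , suc t) ∷ A ∈ picks m k t S (V₁ ++ i ∷ V₂)
∈-picks⁺ m k t S [] {i} {V₂} {A} A∈ = ∈-++⁺ˡ (∈-map⁺ ((i , suc t) ∷_)
  (≡.subst (λ S → A ∈ diagrams m k (suc t) (t ∷ S) V₂) (++-identityʳ S) A∈))
∈-picks⁺ m k t S (l ∷ V₁) {i} {V₂} {A} A∈ = ∈-++⁺ʳ _ (∈-picks⁺ m k t (S ∷ʳ l) V₁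
  (≡.subst (λ S → A ∈ diagrams m k (suc t) (t ∷ S) V₂) (≡.sym (∷ʳ-++ S l V₁)) A∈))

-- Continuations of a partial arc diagram.

-- Describes the members of `diagrams` without recursion. By `sources`, an arc leaves the greatest
-- element of an existing block or a later element, never one that already has an outgoing arc;
-- `first` is the constraint that earlier arcs put on the arc into t + 1.
record Continuation (m t : ℕ) (S V : List ℕ) (A : List Arc) : Set where
  field
    bounds     : All (λ (i , j) → t < j × i < j × j ≤ m ℕ.+ t) A
    compatible : AllPairs Compatible A
    sources    : All (λ (i , j) → i ∈ t ∷ S ++ V ⊎ t < i) A
    first      : All (λ (i , j) → j ≡ suc t → i ∈ t ∷ V) A

open Continuation

Descending : List ℕ → Set
Descending = AllPairs _>_

descending-split : ∀ xs {i ys} → Descending (xs ++ i ∷ ys) →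
                   All (_> i) xs × All (i >_) ys × Descending (xs ++ ys)
descending-split []       (i>ys ∷ ys>) = [] , i>ys , ys>
descending-split (z ∷ xs) (z>  ∷ xs>)
  with xs>i , i>ys , ys> ← descending-split xs xs> | z>xs , z>i ∷ z>ys ← All.++⁻ xs z> =
  z>i ∷ xs>i , i>ys , All.++⁺ z>xs z>ys ∷ ys>

descending-suc : ∀ {t xs} → Descending (t ∷ xs) → Descending (suc t ∷ t ∷ xs)
descending-suc {t} (t> ∷ xs>) = (ℕ.n<1+n t ∷ All.map ℕ.m<n⇒m<1+n t>) ∷ t> ∷ xs>

module _ {t i m : ℕ} {S V S′ V′ : List ℕ} (i∈ : i ∈ t ∷ V) (i≤t : i ≤ t) (V′<i : All (i >_) V′) where

  -- V′ = {l ∈ t ∷ S ++ V | l < i} and S′ ++ V′ = (t ∷ S ++ V) \ {i}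

  continuation-arc⁺ : i ∉ S′ ++ V′ → (∀ {l} → l ∈ S′ ++ V′ → l ∈ t ∷ S ++ V) → ∀ {A} →
                      Continuation m (suc t) S′ V′ A → Continuation (suc m) t S V ((i , suc t) ∷ A)
  continuation-arc⁺ i∉ ⊆F {A} c = record
    { bounds     = (ℕ.≤-refl , s≤s i≤t , s≤s (ℕ.m≤n+m t m)) ∷
        All.map (λ (t<j , i<j , j≤) → ℕ.<⇒≤ t<j , i<j , ℕ.≤-trans j≤ (ℕ.≤-reflexive (ℕ.+-suc m t))) (bounds c)
    ; compatible = All.tabulate (λ a∈A →
          proj₁ (All.lookup (bounds c) a∈A)
        , (λ { refl → i-fresh (All.lookup (sources c) a∈A) })
        , (λ (i<i′ , i′≤t , j≡) → no-crossing i<i′ i′≤t (All.lookup (first c) a∈A j≡)))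
        ∷ compatible c
    ; sources    = inj₁ (F∋ i∈) ∷ All.map old (sources c)
    ; first      = (λ _ → i∈) ∷ All.map (λ { (t<j , _) refl → contradiction t<j (ℕ.<-irrefl refl) }) (bounds c)
    }
    where
    F∋ : i ∈ t ∷ V → i ∈ t ∷ S ++ V
    F∋ (here i≡t)  = here i≡t
    F∋ (there i∈V) = there (∈-++⁺ʳ S i∈V)
    i-fresh : ¬ (i ∈ suc t ∷ S′ ++ V′ ⊎ suc t < i)
    i-fresh (inj₁ (here refl)) = ℕ.<-irrefl refl i≤t
    i-fresh (inj₁ (there i∈′)) = i∉ i∈′
    i-fresh (inj₂ t<i)         = ℕ.<-irrefl refl (ℕ.<-≤-trans t<i (ℕ.m≤n⇒m≤1+n i≤t))
    -- A right crossing with the arc from `i` needs an arc into t + 2 from strictly between `i` and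
    -- t + 1, but `first` allows only t + 1 itself and elements of `V′`, which lie below `i`.
    no-crossing : ∀ {i′} → i < i′ → i′ < suc t → ¬ (i′ ∈ suc t ∷ V′)
    no-crossing i<i′ i′≤t (here refl)   = ℕ.<-irrefl refl i′≤t
    no-crossing i<i′ i′≤t (there i′∈V′) = ℕ.<-asym i<i′ (All.lookup V′<i i′∈V′)
    old : ∀ {l} → l ∈ suc t ∷ S′ ++ V′ ⊎ suc t < l → l ∈ t ∷ S ++ V ⊎ t < l
    old (inj₁ (here refl)) = inj₂ ℕ.≤-refl
    old (inj₁ (there l∈))  = inj₁ (⊆F l∈)
    old (inj₂ t<l)         = inj₂ (ℕ.<⇒≤ t<l)

  continuation-arc⁻ : All (t ≥_) (t ∷ S ++ V) →
                      (∀ {l} → l ∈ t ∷ S ++ V → l ≢ i → l ∈ S′ ++ V′) →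
                      (∀ {l} → l ∈ t ∷ S ++ V → l < i → l ∈ V′) → ∀ {A} →
                      Continuation (suc m) t S V ((i , suc t) ∷ A) → Continuation m (suc t) S′ V′ A
  continuation-arc⁻ F≤t F∖i F<i {A} c with i-compatible ∷ A-compatible ← compatible c
                                   | _ ∷ A-bounds ← bounds c | _ ∷ A-sources ← sources c = record
    { bounds     = All.tabulate λ a∈A → let _ , i<j , j≤ = All.lookup A-bounds a∈A in
        proj₁ (All.lookup i-compatible a∈A) , i<j , ℕ.≤-trans j≤ (ℕ.≤-reflexive (≡.sym (ℕ.+-suc m t)))
    ; compatible = A-compatible
    ; sources    = All.tabulate λ a∈A →
        new (proj₁ (proj₂ (All.lookup i-compatible a∈A)) ∘ ≡.sym) (All.lookup A-sources a∈A)
    ; first      = All.tabulate λ { a∈A refl → let _ , i≢ , ¬crossing = All.lookup i-compatible a∈A in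
        next (proj₁ (proj₂ (All.lookup A-bounds a∈A))) (i≢ ∘ ≡.sym)
          (λ i<i′ i′≤t → ¬crossing (i<i′ , i′≤t , refl)) (All.lookup A-sources a∈A) }
    }
    where
    new : ∀ {l} → l ≢ i → l ∈ t ∷ S ++ V ⊎ t < l → l ∈ suc t ∷ S′ ++ V′ ⊎ suc t < l
    new l≢i (inj₁ l∈F) = inj₁ (there (F∖i l∈F l≢i))
    new l≢i (inj₂ t<l) with ℕ.m≤n⇒m<n∨m≡n t<l
    ... | inj₁ t+1<l = inj₂ t+1<l
    ... | inj₂ refl  = inj₁ (here refl)
    -- The arc into t + 2 starts at t + 1 or at an old greatest element. The latter is at most `t`,
    -- so the absence of a right crossing forces it below `i` and hence into `V′`.
    next : ∀ {l} → l < suc (suc t) → l ≢ i → (i < l → l < suc t → ⊥) →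
           l ∈ t ∷ S ++ V ⊎ t < l → l ∈ suc t ∷ V′
    next l≤t+1 l≢i ¬crossing (inj₁ l∈F) = there (F<i l∈F (ℕ.≤∧≢⇒<
      (ℕ.≮⇒≥ λ i<l → ¬crossing i<l (s≤s (All.lookup F≤t l∈F))) l≢i))
    next l≤t+1 l≢i ¬crossing (inj₂ t<l) = here (ℕ.≤-antisym (ℕ.s≤s⁻¹ l≤t+1) t<l)

module _ {m t : ℕ} {S V : List ℕ} {A : List Arc} where

  -- If t + 1 starts a block, no right crossing can be completed by an arc into t + 2, so all older
  -- blocks are admissible and the new `S` is empty.
  continuation-skip⁺ : Continuation m (suc t) [] (t ∷ S ++ V) A → Continuation (suc m) t S V A
  continuation-skip⁺ c = record
    { bounds     = All.map (λ (t<j , i<j , j≤) → ℕ.<⇒≤ t<j , i<j , ℕ.≤-trans j≤ (ℕ.≤-reflexive (ℕ.+-suc m t))) (bounds c)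
    ; compatible = compatible c
    ; sources    = All.map old (sources c)
    ; first      = All.map (λ { (t<j , _) refl → contradiction t<j (ℕ.<-irrefl refl) }) (bounds c)
    }
    where
    old : ∀ {l} → l ∈ suc t ∷ t ∷ S ++ V ⊎ suc t < l → l ∈ t ∷ S ++ V ⊎ t < l
    old (inj₁ (here refl)) = inj₂ ℕ.≤-refl
    old (inj₁ (there l∈))  = inj₁ l∈
    old (inj₂ t<l)         = inj₂ (ℕ.<⇒≤ t<l)

  continuation-skip⁻ : All (λ (i , j) → suc t < j) A →
                       Continuation (suc m) t S V A → Continuation m (suc t) [] (t ∷ S ++ V) A
  continuation-skip⁻ t+1<j c = record
    { bounds     = All.zipWith (λ (t+1<j , _ , i<j , j≤) →
        t+1<j , i<j , ℕ.≤-trans j≤ (ℕ.≤-reflexive (≡.sym (ℕ.+-suc m t)))) (t+1<j , bounds c)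
    ; compatible = compatible c
    ; sources    = All.map new (sources c)
    ; first      = All.zipWith (λ { ((_ , i<j , _) , i∈) refl → next i<j i∈ }) (bounds c , sources c)
    }
    where
    new : ∀ {l} → l ∈ t ∷ S ++ V ⊎ t < l → l ∈ suc t ∷ t ∷ S ++ V ⊎ suc t < l
    new (inj₁ l∈)  = inj₁ (there l∈)
    new (inj₂ t<l) with ℕ.m≤n⇒m<n∨m≡n t<l
    ... | inj₁ t+1<l = inj₂ t+1<l
    ... | inj₂ refl  = inj₁ (here refl)
    next : ∀ {l} → l < suc (suc t) → l ∈ t ∷ S ++ V ⊎ t < l → l ∈ suc t ∷ t ∷ S ++ V
    next _     (inj₁ l∈)  = there l∈
    next l≤t+1 (inj₂ t<l) = here (ℕ.≤-antisym (ℕ.s≤s⁻¹ l≤t+1) t<l)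

descending-∉ : ∀ xs {i ys} → Descending (xs ++ i ∷ ys) → i ∉ xs ++ ys
descending-∉ xs {i} {ys} d i∈ with xs>i , i>ys , _ ← descending-split xs d | ∈-++⁻ xs i∈
... | inj₁ i∈xs = ℕ.<-irrefl refl (All.lookup xs>i i∈xs)
... | inj₂ i∈ys = ℕ.<-irrefl refl (All.lookup i>ys i∈ys)

descending-≢ : ∀ (xs : List ℕ) {i ys l} → l ∈ xs ++ i ∷ ys → l ≢ i → l ∈ xs ++ ys
descending-≢ xs l∈ l≢i with ∈-++⁻ xs l∈
... | inj₁ l∈xs         = ∈-++⁺ˡ l∈xs
... | inj₂ (here l≡i)   = contradiction l≡i l≢i
... | inj₂ (there l∈ys) = ∈-++⁺ʳ xs l∈ys

descending-< : ∀ xs {i ys l} → Descending (xs ++ i ∷ ys) → l ∈ xs ++ i ∷ ys → l < i → l ∈ ys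
descending-< xs d l∈ l<i with xs>i , _ ← descending-split xs d | ∈-++⁻ xs l∈
... | inj₁ l∈xs         = contradiction l<i (ℕ.<-asym (All.lookup xs>i l∈xs))
... | inj₂ (here refl)  = contradiction l<i (ℕ.<-irrefl refl)
... | inj₂ (there l∈ys) = l∈ys

∈-remove : ∀ (xs : List ℕ) {i ys l} → l ∈ xs ++ ys → l ∈ xs ++ i ∷ ys
∈-remove xs l∈ with ∈-++⁻ xs l∈
... | inj₁ l∈xs = ∈-++⁺ˡ l∈xs
... | inj₂ l∈ys = ∈-++⁺ʳ xs (there l∈ys)

descending-top : ∀ {t xs} → Descending (t ∷ xs) → All (t ≥_) (t ∷ xs)
descending-top (t> ∷ _) = ℕ.≤-refl ∷ All.map ℕ.<⇒≤ t>

descending-remove : ∀ {t xs i ys} → Descending (t ∷ xs ++ i ∷ ys) → Descending (suc t ∷ t ∷ xs ++ ys)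
descending-remove {t} {xs} d = descending-suc (proj₂ (proj₂ (descending-split (t ∷ xs) d)))

-- Soundness, completeness and absence of repetitions for the enumeration.

diagrams-sound : ∀ m k t S V → Descending (t ∷ S ++ V) → ∀ {A} →
                 A ∈ diagrams m k t S V → Continuation m t S V A × length A ≡ k
diagrams-sound zero zero t S V d (here refl) =
  record { bounds = [] ; compatible = [] ; sources = [] ; first = [] } , refl
diagrams-sound (suc m) zero t S V d A∈ with c , l ← diagrams-sound m zero (suc t) [] _ (descending-suc d) A∈ =
  continuation-skip⁺ c , l
diagrams-sound (suc m) (suc k) t S V d A∈ with ∈-++⁻ (diagrams m (suc k) (suc t) [] (t ∷ S ++ V)) A∈
... | inj₁ A∈skip with c , l ← diagrams-sound m (suc k) (suc t) [] _ (descending-suc d) A∈skip =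
  continuation-skip⁺ c , l
... | inj₂ A∈ with ∈-++⁻ (map ((t , suc t) ∷_) (diagrams m k (suc t) [] (S ++ V))) A∈
...   | inj₁ A∈last
  with A′ , A′∈ , refl ← ∈-map⁻ ((t , suc t) ∷_) A∈last | t> ∷ d′ ← d
  with c , refl ← diagrams-sound m k (suc t) [] _ (All.map ℕ.m<n⇒m<1+n t> ∷ d′) A′∈ =
  -- Joining `t` is the split with nothing in front: `S′` is empty and all other blocks stay
  -- admissible.
  continuation-arc⁺ (here refl) ℕ.≤-refl t> (descending-∉ [] d) there c , refl
...   | inj₂ A∈pick
  with V₁ , i , V₂ , A′ , refl , refl , A′∈ ← ∈-picks⁻ m k t S V A∈pick
  with d′ ← ≡.subst (λ xs → Descending (t ∷ xs)) (≡.sym (++-assoc S V₁ (i ∷ V₂))) d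
  with c , refl ← diagrams-sound m k (suc t) (t ∷ S ++ V₁) V₂ (descending-remove d′) A′∈ =
  continuation-arc⁺ (there (∈-++⁺ʳ V₁ (here refl)))
    (All.lookup (descending-top d) (there (∈-++⁺ʳ S (∈-++⁺ʳ V₁ (here refl)))))
    (proj₁ (proj₂ (descending-split (t ∷ S ++ V₁) d′)))
    (descending-∉ (t ∷ S ++ V₁) d′)
    (λ {l} l∈ → ≡.subst (l ∈_) (≡.cong (t ∷_) (++-assoc S V₁ (i ∷ V₂))) (∈-remove (t ∷ S ++ V₁) l∈))
    c
  , refl

-- As right ends increase along `A`, only its first arc can end at t + 1. If it does not, t + 1
-- starts a block; if it does, `first` places its source at `t` or in `V`.
diagrams-complete : ∀ m t S V → Descending (t ∷ S ++ V) → ∀ {A} →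
                    Continuation m t S V A → A ∈ diagrams m (length A) t S V
diagrams-complete zero t S V d {[]} c = here refl
diagrams-complete zero t S V d {_ ∷ _} c with (t<j , _ , j≤t) ∷ _ ← bounds c =
  contradiction t<j (ℕ.≤⇒≯ j≤t)
diagrams-complete (suc m) t S V d {[]} c =
  diagrams-complete m (suc t) [] _ (descending-suc d) (continuation-skip⁻ [] c)
diagrams-complete (suc m) t S V d {(i , j) ∷ A} c with bounds c | j ℕ.≟ suc t
... | (t<j , _) ∷ _ | no j≢ = ∈-++⁺ˡ
  (diagrams-complete m (suc t) [] _ (descending-suc d)
    (continuation-skip⁻ (t+1<j ∷ All.map (λ (j<j′ , _) → ℕ.<-trans t+1<j j<j′) (AllPairs.head (compatible c))) c))
  where t+1<j = ℕ.≤∧≢⇒< t<j (j≢ ∘ ≡.sym)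
... | _ | yes refl with All.head (first c) refl | d
...   | here refl | t> ∷ d′ = ∈-++⁺ʳ (diagrams m (suc (length A)) (suc t) [] (t ∷ S ++ V)) (∈-++⁺ˡ
  (∈-map⁺ ((t , suc t) ∷_) (diagrams-complete m (suc t) [] _ (All.map ℕ.m<n⇒m<1+n t> ∷ d′)
    (continuation-arc⁻ (here refl) ℕ.≤-refl t> (descending-top d) (descending-≢ []) (descending-< [] d) c))))
...   | there i∈V | _ with V₁ , V₂ , refl ← ∈-∃++ i∈V =
  ∈-++⁺ʳ (diagrams m (suc (length A)) (suc t) [] (t ∷ S ++ V)) (∈-++⁺ʳ _
    (∈-picks⁺ m (length A) t S V₁ (diagrams-complete m (suc t) (t ∷ S ++ V₁) V₂ (descending-remove d′)
      (continuation-arc⁻ (there i∈V)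
        (All.lookup (descending-top d) (there (∈-++⁺ʳ S i∈V)))
        (proj₁ (proj₂ (descending-split (t ∷ S ++ V₁) d′)))
        (descending-top d)
        (descending-≢ (t ∷ S ++ V₁) ∘ reassociate)
        (descending-< (t ∷ S ++ V₁) d′ ∘ reassociate)
        c))))
  where
  reassociate : ∀ {l} → l ∈ t ∷ S ++ V₁ ++ i ∷ V₂ → l ∈ (t ∷ S ++ V₁) ++ i ∷ V₂
  reassociate {l} = ≡.subst (l ∈_) (≡.cong (t ∷_) (≡.sym (++-assoc S V₁ (i ∷ V₂))))
  d′ = ≡.subst (λ xs → Descending (t ∷ xs)) (≡.sym (++-assoc S V₁ (i ∷ V₂))) d

-- By soundness all arcs in members of this list end after t + 1.
skip-disjoint : ∀ m k t S V → Descending (t ∷ S ++ V) → ∀ {i A} →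
                (i , suc t) ∷ A ∉ diagrams m k (suc t) [] (t ∷ S ++ V)
skip-disjoint m k t S V d A∈ with (t<t , _) ∷ _ ← bounds (proj₁ (diagrams-sound m k (suc t) [] _ (descending-suc d) A∈)) =
  ℕ.<-irrefl refl t<t

-- The branches are told apart by the arc into t + 1: there is none, or its source differs, because
-- the greatest elements are strictly descending.
diagrams-unique : ∀ m k t S V → Descending (t ∷ S ++ V) → Unique (diagrams m k t S V)
picks-unique : ∀ m k t S V → Descending (t ∷ S ++ V) → Unique (picks m k t S V)
diagrams-unique zero    zero    t S V d = [] ∷ []
diagrams-unique zero    (suc k) t S V d = []
diagrams-unique (suc m) zero    t S V d = diagrams-unique m zero (suc t) [] _ (descending-suc d)
diagrams-unique (suc m) (suc k) t S V d@(t> ∷ d′) = Unique.++⁺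
  (diagrams-unique m (suc k) (suc t) [] _ (descending-suc d))
  (Unique.++⁺
    (Unique.map⁺ ∷-injectiveʳ (diagrams-unique m k (suc t) [] _ (All.map ℕ.m<n⇒m<1+n t> ∷ d′)))
    (picks-unique m k t S V d)
    last-disjoint)
  disjoint
  where
  last-disjoint : ∀ {A} → ¬ (A ∈ map ((t , suc t) ∷_) (diagrams m k (suc t) [] (S ++ V)) × A ∈ picks m k t S V)
  last-disjoint (A∈last , A∈pick)
    with _ , _ , refl ← ∈-map⁻ ((t , suc t) ∷_) A∈last
       | V₁ , _ , _ , _ , refl , refl , _ ← ∈-picks⁻ m k t S V A∈pick =
    ℕ.<-irrefl refl (All.lookup t> (∈-++⁺ʳ S (∈-++⁺ʳ V₁ (here refl))))
  disjoint : ∀ {A} → ¬ (A ∈ diagrams m (suc k) (suc t) [] (t ∷ S ++ V) ×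
                        A ∈ map ((t , suc t) ∷_) (diagrams m k (suc t) [] (S ++ V)) ++ picks m k t S V)
  disjoint (A∈skip , A∈arc) with ∈-++⁻ (map ((t , suc t) ∷_) (diagrams m k (suc t) [] (S ++ V))) A∈arc
  ... | inj₁ A∈last with _ , _ , refl ← ∈-map⁻ ((t , suc t) ∷_) A∈last =
    skip-disjoint m (suc k) t S V d A∈skip
  ... | inj₂ A∈pick with _ , _ , _ , _ , _ , refl , _ ← ∈-picks⁻ m k t S V A∈pick =
    skip-disjoint m (suc k) t S V d A∈skip
picks-unique m k t S []      d = []
picks-unique m k t S (i ∷ V) d = Unique.++⁺
  (Unique.map⁺ ∷-injectiveʳ (diagrams-unique m k (suc t) (t ∷ S) V (descending-remove d)))
  (picks-unique m k t (S ∷ʳ i) V (≡.subst (λ xs → Descending (t ∷ xs)) (≡.sym (∷ʳ-++ S i V)) d))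
  disjoint
  where
  disjoint : ∀ {A} → ¬ (A ∈ map ((i , suc t) ∷_) (diagrams m k (suc t) (t ∷ S) V) × A ∈ picks m k t (S ∷ʳ i) V)
  disjoint (A∈pick , A∈picks)
    with _ , _ , refl ← ∈-map⁻ ((i , suc t) ∷_) A∈pick
       | V₁ , _ , _ , _ , refl , refl , _ ← ∈-picks⁻ m k t (S ∷ʳ i) V A∈picks =
    descending-∉ (t ∷ S) d (∈-++⁺ʳ (t ∷ S) (∈-++⁺ʳ V₁ (here refl)))

-- Set partitions and their arc diagrams

-- These turn out to be exactly the arc lists, sorted by right end, of the set partitions without
-- right crossings: see `arcList-diagram` and `arcList-classes`.
record Diagram (n : ℕ) (A : List Arc) : Set where
  field
    ranges   : All (λ (i , j) → i < j × j < n) A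
    pairwise : AllPairs Compatible A

-- Following the arcs down from l as far as possible ends in the least element of its block.
label : List Arc → ℕ → ℕ
label []            l = l
label ((i , j) ∷ A) l with label A l ℕ.≟ j
... | yes _ = i
... | no  _ = label A l

label-≤ : ∀ {A} → All (λ (i , j) → i < j) A → ∀ l → label A l ≤ l
label-≤ {[]}          []          l = ℕ.≤-refl
label-≤ {(i , j) ∷ A} (i<j ∷ A<) l with label A l ℕ.≟ j
... | yes refl = ℕ.≤-trans (ℕ.<⇒≤ i<j) (label-≤ A< l)
... | no  _    = label-≤ A< l

label-root : ∀ {A l} → All (λ (i , j) → l ≢ j) A → label A l ≡ l
label-root {[]}          []         = refl
label-root {(i , j) ∷ A} {l} (l≢j ∷ l≢) with label A l ℕ.≟ j
... | yes label≡j = contradiction (≡.trans (≡.sym (label-root l≢)) label≡j) l≢j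
... | no  _       = label-root l≢

label-∷-≢ : ∀ {i j} A {l} → label A l ≢ j → label ((i , j) ∷ A) l ≡ label A l
label-∷-≢ {i} {j} A {l} label≢j with label A l ℕ.≟ j
... | yes label≡j = contradiction label≡j label≢j
... | no  _       = refl

label-∷-≡ : ∀ {i j} A {l} → label A l ≡ j → label ((i , j) ∷ A) l ≡ i
label-∷-≡ {i} {j} A {l} label≡j with label A l ℕ.≟ j
... | yes _       = refl
... | no  label≢j = contradiction label≡j label≢j

label-∷-cong : ∀ {i j} A {l m} → label A l ≡ label A m → label ((i , j) ∷ A) l ≡ label ((i , j) ∷ A) m
label-∷-cong {i} {j} A {l} {m} eq with label A l ℕ.≟ j | label A m ℕ.≟ j
... | yes _ | yes _ = refl
... | no  _ | no  _ = eq
... | yes p | no ¬q = contradiction (≡.trans (≡.sym eq) p) ¬q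
... | no ¬p | yes q = contradiction (≡.trans eq q) ¬p

-- `label` treats the head, the arc with the least right end, last. Neither end of the head is a
-- right end of a later arc, so the tail fixes both, and the head then sends `j` to `i`.
label-arc : ∀ {A} → All (λ (i , j) → i < j) A → AllPairs Compatible A →
            ∀ {i j} → (i , j) ∈ A → label A i ≡ label A j
label-arc {_ ∷ A} (i<j ∷ _) (head ∷ _) {i} {j} (here refl) = ≡.trans
  (≡.trans (label-∷-≢ A (ℕ.<⇒≢ i<j ∘ ≡.trans (≡.sym label-i))) label-i)
  (≡.sym (label-∷-≡ A (label-root (All.map (ℕ.<⇒≢ ∘ proj₁) head))))
  where
  label-i : label A i ≡ i
  label-i = label-root (All.map (λ (j<j′ , _) → ℕ.<⇒≢ (ℕ.<-trans i<j j<j′)) head)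
label-arc {_ ∷ A} (_ ∷ A<) (_ ∷ compat) (there a∈A) = label-∷-cong A (label-arc A< compat a∈A)

module DiagramLabel {n : ℕ} {A : List Arc} (diagram : Diagram n A) where
  open Diagram diagram

  arc-< : ∀ {i j} → (i , j) ∈ A → i < j
  arc-< = proj₁ ∘ All.lookup ranges

  arc-bound : ∀ {i j} → (i , j) ∈ A → j < n
  arc-bound = proj₂ ∘ All.lookup ranges

  label-source≡label-target : ∀ {i j} → (i , j) ∈ A → label A i ≡ label A j
  label-source≡label-target = label-arc (All.map proj₁ ranges) pairwise

  target-unique : ∀ {i j j′} → (i , j) ∈ A → (i , j′) ∈ A → j ≡ j′
  target-unique a∈A b∈A with ∈-AllPairs₂ pairwise a∈A b∈A
  ... | inj₁ refl                 = refl
  ... | inj₂ (inj₁ (_ , i≢i , _)) = contradiction refl i≢i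
  ... | inj₂ (inj₂ (_ , i≢i , _)) = contradiction refl i≢i

  -- If no arc ended at `m`, then `m` would be its own label, whereas the label of `l` is at most
  -- `l`.
  incoming-arc : ∀ {l m} → l < m → label A l ≡ label A m → ∃[ i ] (i , m) ∈ A
  incoming-arc {l} {m} l<m eq with Any.any? (λ (_ , j) → m ℕ.≟ j) A
  ... | yes any with (i , _) , a∈A , refl ← find any = i , a∈A
  ... | no ¬any = contradiction
    (ℕ.≤-trans
      (ℕ.≤-reflexive (≡.trans (≡.sym (label-root (All.¬Any⇒All¬ A ¬any))) (≡.sym eq)))
      (label-≤ (All.map proj₁ ranges) l))
    (ℕ.<⇒≱ l<m)

  -- Strong induction on `m`, comparing `l` with the source `i` of the arc into `m`. If `i` lies
  -- below `l`, induction gives an arc from `i` ending at or before `l`, but the only arc from `i`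
  -- ends at `m`.
  outgoing-arc : ∀ m {l} → l < m → label A l ≡ label A m → ∃[ j ] (l , j) ∈ A × j ≤ m
  outgoing-arc = <-rec (λ m → ∀ {l} → l < m → label A l ≡ label A m → ∃[ j ] (l , j) ∈ A × j ≤ m) step
    where
    step : ∀ m → (∀ {m′} → m′ < m → ∀ {l} → l < m′ → label A l ≡ label A m′ → ∃[ j ] (l , j) ∈ A × j ≤ m′) →
           ∀ {l} → l < m → label A l ≡ label A m → ∃[ j ] (l , j) ∈ A × j ≤ m
    step m rec {l} l<m eq with i , a∈A ← incoming-arc l<m eq | ℕ.<-cmp l i
    ... | tri≈ _ refl _ = m , a∈A , ℕ.≤-refl
    ... | tri< l<i _ _ with j , b∈A , j≤i ← rec (arc-< a∈A) l<i (≡.trans eq (≡.sym (label-source≡label-target a∈A))) =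
      j , b∈A , ℕ.≤-trans j≤i (ℕ.<⇒≤ (arc-< a∈A))
    ... | tri> _ _ i<l with j , b∈A , j≤l ← rec l<m i<l (≡.trans (label-source≡label-target a∈A) (≡.sym eq))
                       with refl ← target-unique a∈A b∈A =
      contradiction l<m (ℕ.≤⇒≯ j≤l)

  no-arc-over : ∀ {i l j} → (i , j) ∈ A → i < l → l < j → label A i ≢ label A l
  no-arc-over a∈A i<l l<j eq with j′ , b∈A , j′≤l ← outgoing-arc _ i<l eq with refl ← target-unique a∈A b∈A =
    contradiction l<j (ℕ.≤⇒≯ j′≤l)

-- The label classes of an arc diagram.

module _ (n : ℕ) (A : List Arc) where

  class : Fin n → Subset n
  class i = Vec.tabulate λ l → does (label A (toℕ l) ℕ.≟ label A (toℕ i))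

  isClass? : Decidable (λ B → ∃[ i ] B ≡ class i)
  isClass? B = Fin.any? λ i → Vec.≡-dec Bool._≟_ B (class i)

  -- Filtering `subsets n` gives the blocks without repetition and in the order used by
  -- `setPartitions`, so that partitions can be compared as lists.
  classes : List (Subset n)
  classes = filter isClass? (subsets n)

∈-class⁺ : ∀ {n} A {l i : Fin n} → label A (toℕ l) ≡ label A (toℕ i) → l ∈ₛ class n A i
∈-class⁺ A {l} {i} eq = Vec.lookup⇒[]= l _ (≡.trans (Vec.lookup∘tabulate _ l) (dec-true (label A (toℕ l) ℕ.≟ label A (toℕ i)) eq))

∈-class⁻ : ∀ {n} A {l i : Fin n} → l ∈ₛ class n A i → label A (toℕ l) ≡ label A (toℕ i)
∈-class⁻ A {l} {i} l∈ = witness (label A (toℕ l) ℕ.≟ label A (toℕ i))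
  (≡.trans (≡.sym (Vec.lookup∘tabulate _ l)) (Vec.[]=⇒lookup l∈))
  where
  witness : ∀ {p} {P : Set p} (P? : Dec P) → does P? ≡ true → P
  witness (yes p) refl = p

∈-subsets : ∀ {n} (B : Subset n) → B ∈ subsets n
∈-subsets Vec.[]              = here refl
∈-subsets (outside Vec.∷ B) = ∈-++⁺ˡ (∈-map⁺ (outside Vec.∷_) (∈-subsets B))
∈-subsets (inside Vec.∷ B)  = ∈-++⁺ʳ _ (∈-map⁺ (inside Vec.∷_) (∈-subsets B))

subsets-unique : ∀ n → Unique (subsets n)
subsets-unique zero    = [] ∷ []
subsets-unique (suc n) = Unique.++⁺
  (Unique.map⁺ Vec.∷-injectiveʳ (subsets-unique n))
  (Unique.map⁺ Vec.∷-injectiveʳ (subsets-unique n))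
  disjoint
  where
  disjoint : ∀ {B} → ¬ (B ∈ map (outside Vec.∷_) (subsets n) × B ∈ map (inside Vec.∷_) (subsets n))
  disjoint (B∈out , B∈in) with _ , _ , refl ← ∈-map⁻ (outside Vec.∷_) B∈out
                           with _ , _ , () ← ∈-map⁻ (inside Vec.∷_) B∈in

-- Sublists of a list without repetitions.

module _ {X : Set} where

  ∈-sublists⁻ : ∀ (xs : List X) {zs} → zs ∈ sublists xs → ∀ {z} → z ∈ zs → z ∈ xs
  ∈-sublists⁻ []       (here refl) ()
  ∈-sublists⁻ (x ∷ xs) zs∈ z∈ with ∈-++⁻ (sublists xs) zs∈
  ... | inj₁ zs∈′ = there (∈-sublists⁻ xs zs∈′ z∈)
  ... | inj₂ zs∈′ with zs′ , zs′∈ , refl ← ∈-map⁻ (x ∷_) zs∈′ with z∈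
  ...   | here refl = here refl
  ...   | there z∈′ = there (∈-sublists⁻ xs zs′∈ z∈′)

  sublists-unique : ∀ {xs : List X} → Unique xs → Unique (sublists xs)
  sublists-unique {[]}     []          = [] ∷ []
  sublists-unique {x ∷ xs} (x≢xs ∷ xs!) = Unique.++⁺
    (sublists-unique xs!)
    (Unique.map⁺ ∷-injectiveʳ (sublists-unique xs!))
    disjoint
    where
    disjoint : ∀ {zs} → ¬ (zs ∈ sublists xs × zs ∈ map (x ∷_) (sublists xs))
    disjoint (zs∈ , x∷zs∈) with _ , _ , refl ← ∈-map⁻ (x ∷_) x∷zs∈ =
      All.lookup x≢xs (∈-sublists⁻ xs zs∈ (here refl)) refl

  module _ {p : Level} {P : Pred X p} (P? : Decidable P) where

    filter∈sublists : ∀ xs → filter P? xs ∈ sublists xs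
    filter∈sublists []       = here refl
    filter∈sublists (x ∷ xs) with does (P? x)
    ... | true  = ∈-++⁺ʳ (sublists xs) (∈-map⁺ (x ∷_) (filter∈sublists xs))
    ... | false = ∈-++⁺ˡ (filter∈sublists xs)

    -- A sublist keeps the order of `xs`, so its members determine it.
    sublist≡filter : ∀ {xs} → Unique xs → ∀ {zs} → zs ∈ sublists xs →
                     (∀ {z} → z ∈ xs → z ∈ zs ⇔ P z) → zs ≡ filter P? xs
    sublist≡filter {[]}     _            (here refl) _ = refl
    sublist≡filter {x ∷ xs} (x≢xs ∷ xs!) {zs} zs∈ zs⇔P with ∈-++⁻ (sublists xs) zs∈ | P? x
    ... | inj₁ zs∈′ | no  _  = sublist≡filter xs! zs∈′ (zs⇔P ∘ there)
    ... | inj₁ zs∈′ | yes Px = contradiction refl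
      (All.lookup x≢xs (∈-sublists⁻ xs zs∈′ (from (zs⇔P (here refl)) Px)))
    ... | inj₂ zs∈′ | Px? with zs′ , zs′∈ , refl ← ∈-map⁻ (x ∷_) zs∈′ with Px?
    ...   | no ¬Px = contradiction (to (zs⇔P (here refl)) (here refl)) ¬Px
    ...   | yes _  = ≡.cong (x ∷_) (sublist≡filter xs! zs′∈ λ {z} z∈xs → mk⇔
      (to (zs⇔P (there z∈xs)) ∘ there)
      (λ Pz → drop z∈xs (from (zs⇔P (there z∈xs)) Pz)))
      where
      drop : ∀ {z} → z ∈ xs → z ∈ x ∷ zs′ → z ∈ zs′
      drop z∈xs (here refl)  = contradiction refl (All.lookup x≢xs z∈xs)
      drop z∈xs (there z∈zs′) = z∈zs′

-- Recovering a set partition from its arcs.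

Represents : ∀ {n} → List (Subset n) → List Arc → Set
Represents π A = ∀ i j → IsArc π (i , j) ⇔ (toℕ i , toℕ j) ∈ A

-- As long as some element of `B` lies strictly between `l` and `m`, the search restarts from it;
-- `d` bounds the remaining distance.
predecessor : ∀ {n} (B : Subset n) d {l m} → toℕ m ≤ d ℕ.+ toℕ l → l ∈ₛ B → m ∈ₛ B → l Fin.< m →
              ∃[ i ] Consecutive B i m × l Fin.≤ i
predecessor B zero    m≤l   l∈ m∈ l<m = contradiction l<m (ℕ.≤⇒≯ m≤l)
predecessor B (suc d) {l} {m} m≤d+l l∈ m∈ l<m
  with Fin.any? (λ i → l Fin.<? i ×-dec i Fin.<? m ×-dec i ∈? B)
... | no ¬∃ = l , (l∈ , m∈ , l<m , λ i l<i i<m i∈ → ¬∃ (i , l<i , i<m , i∈)) , ℕ.≤-refl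
... | yes (l′ , l<l′ , l′<m , l′∈)
  with i , consecutive , l′≤i ← predecessor B d
         (ℕ.≤-trans m≤d+l (ℕ.≤-trans (ℕ.≤-reflexive (≡.sym (ℕ.+-suc d (toℕ l)))) (ℕ.+-monoʳ-≤ d l<l′)))
         l′∈ m∈ l′<m =
  i , consecutive , ℕ.≤-trans (ℕ.<⇒≤ l<l′) l′≤i

module SetPartition {n : ℕ} {π : List (Subset n)} (isSetPartition : IsSetPartition π) where

  block-unique : ∀ {B C i} → B ∈ π → C ∈ π → i ∈ₛ B → i ∈ₛ C → B ≡ C
  block-unique B∈π C∈π i∈B i∈C with ∈-AllPairs₂ (proj₁ (proj₂ isSetPartition)) B∈π C∈π
  ... | inj₁ B≡C            = B≡C
  ... | inj₂ (inj₁ disjoint) = contradiction (_ , x∈p∩q⁺ (i∈B , i∈C)) disjoint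
  ... | inj₂ (inj₂ disjoint) = contradiction (_ , x∈p∩q⁺ (i∈C , i∈B)) disjoint

  block : ∀ i → ∃[ B ] B ∈ π × i ∈ₛ B
  block i = find (proj₂ (proj₂ isSetPartition) i)

  arc-< : ∀ {i j} → IsArc π (i , j) → i Fin.< j
  arc-< arc with _ , _ , _ , _ , i<j , _ ← find arc = i<j

  arc-source-unique : ∀ {i i′ j} → IsArc π (i , j) → IsArc π (i′ , j) → i ≡ i′
  arc-source-unique {i} {i′} arc arc′
    with B , B∈π , i∈ , j∈ , i<j , gap ← find arc | B′ , B′∈π , i′∈ , j∈′ , i′<j , gap′ ← find arc′
    with refl ← block-unique B∈π B′∈π j∈ j∈′ | Fin.<-cmp i i′
  ... | tri< i<i′ _ _ = contradiction i′∈ (gap i′ i<i′ i′<j)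
  ... | tri≈ _ i≡i′ _ = i≡i′
  ... | tri> _ _ i′<i = contradiction i∈ (gap′ i i′<i i<j)

  arc-target-unique : ∀ {i j j′} → IsArc π (i , j) → IsArc π (i , j′) → j ≡ j′
  arc-target-unique {i} {j} {j′} arc arc′
    with B , B∈π , i∈ , j∈ , i<j , gap ← find arc | B′ , B′∈π , i∈′ , j′∈ , i<j′ , gap′ ← find arc′
    with refl ← block-unique B∈π B′∈π i∈ i∈′ | Fin.<-cmp j j′
  ... | tri< j<j′ _ _ = contradiction j∈ (gap′ j i<j j<j′)
  ... | tri≈ _ j≡j′ _ = j≡j′
  ... | tri> _ _ j′<j = contradiction j′∈ (gap j′ i<j′ j′<j)

  module _ {A : List Arc} (diagram : Diagram n A) (represents : Represents π A) where
    open DiagramLabel diagram using (label-source≡label-target; incoming-arc)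

    -- Induction on the larger element `m`: its predecessor in the block is not below `l` and is
    -- joined to `m` by an arc, which preserves labels.
    same-block⇒same-label-< : ∀ {B} → B ∈ π → ∀ d {l m} → toℕ m ≡ d → l Fin.< m → l ∈ₛ B → m ∈ₛ B →
                              label A (toℕ l) ≡ label A (toℕ m)
    same-block⇒same-label-< {B} B∈π = <-rec _ step
      where
      step : ∀ d → (∀ {e} → e < d → ∀ {l m} → toℕ m ≡ e → l Fin.< m → l ∈ₛ B → m ∈ₛ B →
                     label A (toℕ l) ≡ label A (toℕ m)) →
             ∀ {l m} → toℕ m ≡ d → l Fin.< m → l ∈ₛ B → m ∈ₛ B → label A (toℕ l) ≡ label A (toℕ m)
      step d rec {l} {m} refl l<m l∈ m∈
        with i , consecutive@(i∈ , _ , i<m , _) , l≤i ← predecessor B (toℕ m) (ℕ.m≤m+n _ _) l∈ m∈ l<m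
        with im ← label-source≡label-target (to (represents i m) (lose B∈π consecutive)) | ℕ.m≤n⇒m<n∨m≡n l≤i
      ... | inj₁ l<i = ≡.trans (rec i<m refl l<i l∈ i∈) im
      ... | inj₂ l≡i = ≡.trans (≡.cong (label A) l≡i) im

    same-block⇒same-label : ∀ {B} → B ∈ π → ∀ {l m} → l ∈ₛ B → m ∈ₛ B → label A (toℕ l) ≡ label A (toℕ m)
    same-block⇒same-label B∈π {l} {m} l∈ m∈ with Fin.<-cmp l m
    ... | tri< l<m _ _  = same-block⇒same-label-< B∈π _ refl l<m l∈ m∈
    ... | tri≈ _ refl _ = refl
    ... | tri> _ _ m<l  = ≡.sym (same-block⇒same-label-< B∈π _ refl m<l m∈ l∈)

    SameBlock : Fin n → Fin n → Set
    SameBlock l m = ∀ {B} → B ∈ π → l ∈ₛ B ⇔ m ∈ₛ B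

    arc⇒SameBlock : ∀ {i j} → IsArc π (i , j) → SameBlock i j
    arc⇒SameBlock arc B∈π with C , C∈π , i∈C , j∈C , _ ← find arc = mk⇔
      (λ i∈B → ≡.subst (_ ∈ₛ_) (block-unique C∈π B∈π i∈C i∈B) j∈C)
      (λ j∈B → ≡.subst (_ ∈ₛ_) (block-unique C∈π B∈π j∈C j∈B) i∈C)

    -- Induction on `m` along the arc of `A` into `m`: its source shares label and block with `m`,
    -- and may lie on either side of `l`.
    same-label⇒SameBlock-< : ∀ d {l m} → toℕ m ≡ d → l Fin.< m → label A (toℕ l) ≡ label A (toℕ m) → SameBlock l m
    same-label⇒SameBlock-< = <-rec _ step
      where
      step : ∀ d → (∀ {e} → e < d → ∀ {l m} → toℕ m ≡ e → l Fin.< m →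
                     label A (toℕ l) ≡ label A (toℕ m) → SameBlock l m) →
             ∀ {l m} → toℕ m ≡ d → l Fin.< m → label A (toℕ l) ≡ label A (toℕ m) → SameBlock l m
      step d rec {l} {m} refl l<m eq B∈π with iℕ , a∈A ← incoming-arc l<m eq = lemma B∈π
        where
        i<n : iℕ < n
        i<n = ℕ.<-trans (DiagramLabel.arc-< diagram a∈A) (Fin.toℕ<n m)
        i : Fin n
        i = fromℕ< i<n
        im∈A : (toℕ i , toℕ m) ∈ A
        im∈A = ≡.subst (λ k → (k , toℕ m) ∈ A) (≡.sym (Fin.toℕ-fromℕ< i<n)) a∈A
        i<m : i Fin.< m
        i<m = DiagramLabel.arc-< diagram im∈A
        arc : IsArc π (i , m)
        arc = from (represents i m) im∈A
        li : label A (toℕ l) ≡ label A (toℕ i)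
        li = ≡.trans eq (≡.sym (label-source≡label-target im∈A))
        lemma : SameBlock l m
        lemma B∈π with Fin.<-cmp l i
        ... | tri< l<i _ _  = mk⇔
          (to (arc⇒SameBlock arc B∈π) ∘ to (rec i<m refl l<i li B∈π))
          (from (rec i<m refl l<i li B∈π) ∘ from (arc⇒SameBlock arc B∈π))
        ... | tri≈ _ refl _ = arc⇒SameBlock arc B∈π
        ... | tri> _ _ i<l  = mk⇔
          (to (arc⇒SameBlock arc B∈π) ∘ from (rec l<m refl i<l (≡.sym li) B∈π))
          (to (rec l<m refl i<l (≡.sym li) B∈π) ∘ from (arc⇒SameBlock arc B∈π))

    same-label⇒SameBlock : ∀ {l m} → label A (toℕ l) ≡ label A (toℕ m) → SameBlock l m
    same-label⇒SameBlock {l} {m} eq B∈π with Fin.<-cmp l m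
    ... | tri< l<m _ _  = same-label⇒SameBlock-< _ refl l<m eq B∈π
    ... | tri≈ _ refl _ = mk⇔ (λ l∈ → l∈) (λ l∈ → l∈)
    ... | tri> _ _ m<l  = let e = same-label⇒SameBlock-< _ refl m<l (≡.sym eq) B∈π in mk⇔ (from e) (to e)

    block≡class : ∀ {B i} → B ∈ π → i ∈ₛ B → B ≡ class n A i
    block≡class B∈π i∈ = ⊆-antisym
      (λ l∈ → ∈-class⁺ A (same-block⇒same-label B∈π l∈ i∈))
      (λ l∈ → from (same-label⇒SameBlock (∈-class⁻ A l∈) B∈π) i∈)

    -- Both lists are sublists of `subsets n`, so equal members suffice. This is what makes
    -- `arcList` injective on the partitions that are counted.
    partition≡classes : π ∈ sublists (subsets n) → π ≡ classes n A
    partition≡classes π∈ = sublist≡filter (isClass? n A) (subsets-unique n) π∈ λ {B} _ → mk⇔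
      (λ B∈π → let i , i∈ = All.lookup (proj₁ isSetPartition) B∈π in i , block≡class B∈π i∈)
      λ { (i , refl) → let B , B∈π , i∈B = block i in ≡.subst (_∈ π) (block≡class B∈π i∈B) B∈π }

AllPairs-upgrade : ∀ {X : Set} {R S : Rel X 0ℓ} {P : Pred X 0ℓ} →
                   (∀ {a b} → P a → P b → R a b → S a b) →
                   ∀ {xs} → All P xs → AllPairs R xs → AllPairs S xs
AllPairs-upgrade f []         []         = []
AllPairs-upgrade f (px ∷ pxs) (rx ∷ rxs) =
  All.zipWith (λ (py , rxy) → f px py rxy) (pxs , rx) ∷ AllPairs-upgrade f pxs rxs

-- Realising a diagram by a set partition.

module _ {n : ℕ} {A : List Arc} (diagram : Diagram n A) where
  open DiagramLabel diagram

  classes-isSetPartition : IsSetPartition (classes n A)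
  classes-isSetPartition =
      All.map (λ { (i , refl) → i , ∈-class⁺ A refl }) (All.all-filter (isClass? n A) (subsets n))
    , AllPairs-upgrade disjoint (All.all-filter (isClass? n A) (subsets n))
        (Unique.filter⁺ (isClass? n A) (subsets-unique n))
    , λ i → lose (∈-filter⁺ (isClass? n A) (∈-subsets (class n A i)) (i , refl)) (∈-class⁺ A refl)
    where
    disjoint : ∀ {B C} → ∃[ i ] B ≡ class n A i → ∃[ j ] C ≡ class n A j → B ≢ C → ¬ (∃[ l ] l ∈ₛ (B ∩ C))
    disjoint (i , refl) (j , refl) B≢C (l , l∈) = B≢C (⊆-antisym
      (λ m∈ → ∈-class⁺ A (≡.trans (∈-class⁻ A m∈) i≡j))
      (λ m∈ → ∈-class⁺ A (≡.trans (∈-class⁻ A m∈) (≡.sym i≡j))))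
      where
      i≡j : label A (toℕ i) ≡ label A (toℕ j)
      i≡j = ≡.trans (≡.sym (∈-class⁻ A (proj₁ (x∈p∩q⁻ _ _ l∈)))) (∈-class⁻ A (proj₂ (x∈p∩q⁻ _ _ l∈)))

  -- If `i` and `j` are consecutive in a class, the arc leaving `i` ends inside the class at or
  -- before `j`, hence at `j`. Conversely, `no-arc-over` keeps the class away from the inside of an
  -- arc.
  classes-represents : Represents (classes n A) A
  classes-represents i j = mk⇔ forward backward
    where
    forward : IsArc (classes n A) (i , j) → (toℕ i , toℕ j) ∈ A
    forward arc
      with B , B∈ , i∈ , j∈ , i<j , gap ← find arc
      with _ , r , refl ← ∈-filter⁻ (isClass? n A) {xs = subsets n} B∈
      with m , a∈A , m≤j ← outgoing-arc (toℕ j) i<j (≡.trans (∈-class⁻ A i∈) (≡.sym (∈-class⁻ A j∈)))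
      with ℕ.m≤n⇒m<n∨m≡n m≤j
    ... | inj₂ refl = a∈A
    ... | inj₁ m<j  = contradiction
      (∈-class⁺ A (≡.trans (≡.cong (label A) (Fin.toℕ-fromℕ< m<n))
        (≡.trans (≡.sym (label-source≡label-target a∈A)) (∈-class⁻ A i∈))))
      (gap (fromℕ< m<n)
        (ℕ.<-≤-trans (arc-< a∈A) (ℕ.≤-reflexive (≡.sym (Fin.toℕ-fromℕ< m<n))))
        (ℕ.≤-<-trans (ℕ.≤-reflexive (Fin.toℕ-fromℕ< m<n)) m<j))
      where
      m<n : m < n
      m<n = arc-bound a∈A
    backward : (toℕ i , toℕ j) ∈ A → IsArc (classes n A) (i , j)
    backward a∈A = lose (∈-filter⁺ (isClass? n A) (∈-subsets (class n A i)) (i , refl))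
      ( ∈-class⁺ A refl
      , ∈-class⁺ A (≡.sym (label-source≡label-target a∈A))
      , arc-< a∈A
      , λ l i<l l<j l∈ → no-arc-over a∈A i<l l<j (≡.sym (∈-class⁻ A l∈)))

-- The sorted arc list of a set partition.

module _ {n : ℕ} where

  -- The right end varies in the outer loop, unlike in `arcs`, so that filtering yields the order
  -- required by `Compatible`.
  arcsByTarget : List (Fin n × Fin n)
  arcsByTarget = cartesianProductWith (λ j i → i , j) (allFin n) (allFin n)

  toArc : Fin n × Fin n → Arc
  toArc (i , j) = toℕ i , toℕ j

  arcList : List (Subset n) → List Arc
  arcList π = map toArc (filter (isArc? π) arcsByTarget)

  toArc-injective : ∀ {a b} → toArc a ≡ toArc b → a ≡ b
  toArc-injective eq = ≡.cong₂ _,_ (Fin.toℕ-injective (≡.cong proj₁ eq)) (Fin.toℕ-injective (≡.cong proj₂ eq))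

  ∈-arcsByTarget : ∀ a → a ∈ arcsByTarget
  ∈-arcsByTarget (i , j) = ∈-cartesianProductWith⁺ (λ j i → i , j) (∈-allFin j) (∈-allFin i)

  arcsByTarget-unique : Unique arcsByTarget
  arcsByTarget-unique = Unique.cartesianProductWith⁺ (λ j i → i , j) (λ { refl → refl , refl })
    (Unique.allFin⁺ n) (Unique.allFin⁺ n)

  arcsByTarget-sorted : AllPairs (λ a b → proj₂ a Fin.≤ proj₂ b) arcsByTarget
  arcsByTarget-sorted = sorted (allFin n) (AllPairs.tabulate⁺-< λ i<j → i<j)
    where
    sorted : ∀ js → AllPairs Fin._<_ js →
             AllPairs (λ a b → proj₂ a Fin.≤ proj₂ b) (cartesianProductWith (λ j i → i , j) js (allFin n))
    sorted []       []             = []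
    sorted (j ∷ js) (j<js ∷ js<) = AllPairs.++⁺
      (AllPairs.map⁺ (AllPairs.tabulate⁺ λ _ → ℕ.≤-refl))
      (sorted js js<)
      (All.map⁺ (All.tabulate λ {i} _ → All.tabulate λ a∈ → lower a∈))
      where
      lower : ∀ {a} → a ∈ cartesianProductWith (λ j i → i , j) js (allFin n) → j Fin.≤ proj₂ a
      lower a∈ with _ , _ , j′∈ , _ , refl ← ∈-cartesianProductWith⁻ (λ j i → i , j) js (allFin n) a∈ =
        ℕ.<⇒≤ (All.lookup j<js j′∈)

  arcList-represents : ∀ π → Represents π (arcList π)
  arcList-represents π i j = mk⇔
    (λ arc → ∈-map⁺ toArc (∈-filter⁺ (isArc? π) (∈-arcsByTarget (i , j)) arc))
    (λ a∈ → let a , a∈′ , eq = ∈-map⁻ toArc a∈ in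
      ≡.subst (IsArc π) (≡.sym (toArc-injective eq)) (proj₂ (∈-filter⁻ (isArc? π) {xs = arcsByTarget} a∈′)))

  ∈-arcs : ∀ {π} {a : Fin n × Fin n} → IsArc π a → a ∈ arcs π
  ∈-arcs {π} {i , j} arc = ∈-filter⁺ (isArc? π) (∈-cartesianProduct⁺ (∈-allFin i) (∈-allFin j)) arc

  ∈-arcs⁻ : ∀ {π} {a : Fin n × Fin n} → a ∈ arcs π → IsArc π a
  ∈-arcs⁻ {π} a∈ = proj₂ (∈-filter⁻ (isArc? π) {xs = cartesianProduct (allFin n) (allFin n)} a∈)

unique∧set⇒length : ∀ {X : Set} {xs ys : List X} → Unique xs → Unique ys →
                    (∀ {z} → z ∈ xs → z ∈ ys) → (∀ {z} → z ∈ ys → z ∈ xs) → length xs ≡ length ys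
unique∧set⇒length xs! ys! xs⊆ys ys⊆xs = ↭-length (∼bag⇒↭ (unique∧set⇒bag xs! ys! (mk⇔ xs⊆ys ys⊆xs)))

length-arcList : ∀ {n} (π : List (Subset n)) → length (arcList π) ≡ length (arcs π)
length-arcList {n} π = ≡.trans (length-map toArc (filter (isArc? π) arcsByTarget)) (unique∧set⇒length
  (Unique.filter⁺ (isArc? π) arcsByTarget-unique)
  (Unique.filter⁺ (isArc? π) (Unique.cartesianProduct⁺ (Unique.allFin⁺ n) (Unique.allFin⁺ n)))
  (λ a∈ → ∈-arcs (proj₂ (∈-filter⁻ (isArc? π) {xs = arcsByTarget} a∈)))
  (λ {a} a∈ → ∈-filter⁺ (isArc? π) (∈-arcsByTarget a) (∈-arcs⁻ {π = π} a∈)))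

-- The enumeration is sorted only weakly by right end. Distinct arcs of a set partition share
-- neither right ends nor left ends, which makes the order strict.
arcList-diagram : ∀ {n} {π : List (Subset n)} → IsSetPartition π → ¬ HasRightCrossing π → Diagram n (arcList π)
arcList-diagram {n} {π} isSetPartition ¬crossing = record
  { ranges   = All.map⁺ (All.map (λ {a} arc → arc-< arc , Fin.toℕ<n (proj₂ a)) isArcs)
  ; pairwise = AllPairs.map⁺ (AllPairs-upgrade compat isArcs
      (AllPairs.filter⁺ (isArc? π) (AllPairs.zip (arcsByTarget-unique , arcsByTarget-sorted))))
  }
  where
  open SetPartition isSetPartition
  isArcs : All (IsArc π) (filter (isArc? π) arcsByTarget)
  isArcs = All.all-filter (isArc? π) arcsByTarget
  compat : ∀ {a b} → IsArc π a → IsArc π b → a ≢ b × proj₂ a Fin.≤ proj₂ b → Compatible (toArc a) (toArc b)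
  compat {i , j} {i′ , j′} arc arc′ (a≢b , j≤j′) = j<j′ , i≢i′ , λ (i<i′ , i′<j , j′≡) →
    ¬crossing (lose (∈-arcs arc) (lose (∈-arcs arc′) (i<i′ , i′<j , j<j′ , j′≡)))
    where
    j≢j′ : toℕ j ≢ toℕ j′
    j≢j′ eq with refl ← Fin.toℕ-injective eq = a≢b (≡.cong (_, j) (arc-source-unique arc arc′))
    j<j′ : j Fin.< j′
    j<j′ = ℕ.≤∧≢⇒< j≤j′ j≢j′
    i≢i′ : toℕ i ≢ toℕ i′
    i≢i′ eq with refl ← Fin.toℕ-injective eq = j≢j′ (≡.cong toℕ (arc-target-unique arc arc′))

-- If the heads differed, each would occur in the tail of the other list, and so each would have the
-- smaller right end.
sorted-unique : ∀ {A B} → AllPairs (λ a b → proj₂ a < proj₂ b) A → AllPairs (λ a b → proj₂ a < proj₂ b) B →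
                (∀ {a : Arc} → a ∈ A → a ∈ B) → (∀ {a} → a ∈ B → a ∈ A) → A ≡ B
sorted-unique {[]}    {[]}    _ _ _ _ = refl
sorted-unique {[]}    {b ∷ B} _ _ _ B⊆A with () ← B⊆A (here refl)
sorted-unique {a ∷ A} {[]}    _ _ A⊆B _ with () ← A⊆B (here refl)
sorted-unique {a ∷ A} {b ∷ B} (a<A ∷ A<) (b<B ∷ B<) A⊆B B⊆A = ≡.cong₂ _∷_ a≡b
  (sorted-unique A< B< (λ c∈A → drop a<A c∈A a≡b (A⊆B (there c∈A)))
    (λ c∈B → drop b<B c∈B (≡.sym a≡b) (B⊆A (there c∈B))))
  where
  a≡b : a ≡ b
  a≡b with A⊆B (here refl) | B⊆A (here refl)
  ... | here a≡b  | _         = a≡b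
  ... | there _   | here b≡a  = ≡.sym b≡a
  ... | there a∈B | there b∈A = contradiction (All.lookup a<A b∈A) (ℕ.<-asym (All.lookup b<B a∈B))
  drop : ∀ {a b c} {A B : List Arc} → All (λ c → proj₂ a < proj₂ c) A → c ∈ A → a ≡ b → c ∈ b ∷ B → c ∈ B
  drop a<A c∈A refl (here refl) = contradiction (All.lookup a<A c∈A) (ℕ.<-irrefl refl)
  drop a<A c∈A a≡b  (there c∈B) = c∈B

module _ {n : ℕ} {A : List Arc} (diagram : Diagram n A) where
  open DiagramLabel diagram

  classes-¬HasRightCrossing : ¬ HasRightCrossing (classes n A)
  classes-¬HasRightCrossing crossing
    with (i , j) , a∈ , crossing′ ← find crossing
    with (i′ , j′) , b∈ , i<i′ , i′<j , j<j′ , j′≡ ← find crossing′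
    with ∈-AllPairs₂ (Diagram.pairwise diagram)
           (to (classes-represents diagram i j) (∈-arcs⁻ {π = classes n A} a∈))
           (to (classes-represents diagram i′ j′) (∈-arcs⁻ {π = classes n A} b∈))
  ... | inj₁ eq                         = ℕ.<⇒≢ j<j′ (≡.cong proj₂ eq)
  ... | inj₂ (inj₁ (_ , _ , ¬crossing)) = ¬crossing (i<i′ , i′<j , j′≡)
  ... | inj₂ (inj₂ (j′<j , _))          = ℕ.<-asym j<j′ j′<j

  arcList-classes : arcList (classes n A) ≡ A
  arcList-classes = sorted-unique
    (AllPairs.map proj₁ (Diagram.pairwise
      (arcList-diagram (classes-isSetPartition diagram) classes-¬HasRightCrossing)))
    (AllPairs.map proj₁ (Diagram.pairwise diagram))
    forward backward
    where
    forward : ∀ {a} → a ∈ arcList (classes n A) → a ∈ A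
    forward a∈ with (i , j) , a∈′ , refl ← ∈-map⁻ toArc a∈ =
      to (classes-represents diagram i j) (proj₂ (∈-filter⁻ (isArc? (classes n A)) {xs = arcsByTarget} a∈′))
    backward : ∀ {a} → a ∈ A → a ∈ arcList (classes n A)
    backward {i , j} a∈A = ≡.subst (_∈ arcList (classes n A))
      (≡.cong₂ _,_ (Fin.toℕ-fromℕ< i<n) (Fin.toℕ-fromℕ< j<n))
      (to (arcList-represents (classes n A) (fromℕ< i<n) (fromℕ< j<n))
        (from (classes-represents diagram (fromℕ< i<n) (fromℕ< j<n))
          (≡.subst (_∈ A) (≡.sym (≡.cong₂ _,_ (Fin.toℕ-fromℕ< i<n) (Fin.toℕ-fromℕ< j<n))) a∈A)))
      where
      j<n = arc-bound a∈A
      i<n = ℕ.<-trans (arc-< a∈A) j<n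

-- Counting set partitions by diagrams.

continuation⇒diagram : ∀ {m A} → Continuation m 0 [] [] A → Diagram (suc m) A
continuation⇒diagram {m} c = record
  { ranges   = All.map (λ (_ , i<j , j≤m) → i<j , s≤s (ℕ.≤-trans j≤m (ℕ.≤-reflexive (ℕ.+-identityʳ m))))
      (Continuation.bounds c)
  ; pairwise = Continuation.compatible c
  }

-- The start is the single element 0: every source is 0 or later, and an arc into 1 can only come
-- from 0.
diagram⇒continuation : ∀ {m A} → Diagram (suc m) A → Continuation m 0 [] [] A
diagram⇒continuation {m} d = record
  { bounds     = All.map (λ (i<j , j<n) →
      ℕ.≤-<-trans z≤n i<j , i<j , ℕ.≤-trans (ℕ.s≤s⁻¹ j<n) (ℕ.≤-reflexive (≡.sym (ℕ.+-identityʳ m))))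
      (Diagram.ranges d)
  ; compatible = Diagram.pairwise d
  ; sources    = All.universal (λ (i , _) → source i) _
  ; first      = All.map (λ { (i<j , _) refl → here (ℕ.n<1⇒n≡0 i<j) }) (Diagram.ranges d)
  }
  where
  source : ∀ i → i ∈ 0 ∷ [] ⊎ 0 < i
  source zero    = inj₁ (here refl)
  source (suc i) = inj₂ (s≤s z≤n)

-- The decision procedure is a parameter because the one in `CT` is local to its `where` block;
-- unification supplies it in `CT≡count`.
module _ {n k : ℕ}
  (counted? : Decidable (λ (π : List (Subset (suc n))) → length (arcs π) ≡ k × ¬ HasRightCrossing π)) where

  private
    partitions : List (List (Subset (suc n)))
    partitions = filter counted? (setPartitions (suc n))

    ∈-partitions⁻ : ∀ {π} → π ∈ partitions →
      π ∈ sublists (subsets (suc n)) × IsSetPartition π × length (arcs π) ≡ k × ¬ HasRightCrossing π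
    ∈-partitions⁻ π∈ with π∈′ , counted ← ∈-filter⁻ counted? {xs = setPartitions (suc n)} π∈
                     with π∈″ , sp ← ∈-filter⁻ isSetPartition? {xs = sublists (subsets (suc n))} π∈′ =
      π∈″ , sp , counted

    partitions-unique : Unique partitions
    partitions-unique = Unique.filter⁺ counted? (Unique.filter⁺ isSetPartition?
      (sublists-unique (subsets-unique (suc n))))

    π≡classes : ∀ {π} → π ∈ partitions → π ≡ classes (suc n) (arcList π)
    π≡classes {π} π∈ with π∈′ , sp , _ , ¬crossing ← ∈-partitions⁻ π∈ =
      SetPartition.partition≡classes sp (arcList-diagram sp ¬crossing) (arcList-represents π) π∈′

    arcLists-unique : Unique (map arcList partitions)
    arcLists-unique = AllPairs.map⁺ (AllPairs-upgrade
      (λ π∈ ρ∈ π≢ρ eq → π≢ρ (≡.trans (π≡classes π∈)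
        (≡.trans (≡.cong (classes (suc n)) eq) (≡.sym (π≡classes ρ∈)))))
      (All.tabulate λ π∈ → π∈) partitions-unique)

    forward : ∀ {A} → A ∈ map arcList partitions → A ∈ diagrams n k 0 [] []
    forward A∈ with π , π∈ , refl ← ∈-map⁻ arcList A∈ with _ , sp , refl , ¬crossing ← ∈-partitions⁻ π∈ =
      ≡.subst (λ l → arcList π ∈ diagrams n l 0 [] []) (length-arcList π)
        (diagrams-complete n 0 [] [] ([] ∷ []) (diagram⇒continuation (arcList-diagram sp ¬crossing)))

    backward : ∀ {A} → A ∈ diagrams n k 0 [] [] → A ∈ map arcList partitions
    backward {A} A∈ with c , length≡k ← diagrams-sound n k 0 [] [] ([] ∷ []) A∈ =
      ≡.subst (_∈ map arcList partitions) (arcList-classes d) (∈-map⁺ arcList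
        (∈-filter⁺ counted?
          (∈-filter⁺ isSetPartition?
            (filter∈sublists (isClass? (suc n) A) (subsets (suc n)))
            (classes-isSetPartition d))
          ( ≡.trans (≡.sym (length-arcList (classes (suc n) A)))
              (≡.trans (≡.cong length (arcList-classes d)) length≡k)
          , classes-¬HasRightCrossing d)))
      where d = continuation⇒diagram c

  -- `arcList` is a bijection from the counted partitions to `diagrams n k 0 [] []`: `π≡classes`
  -- makes it injective, and the `classes` of a diagram are a preimage.
  length-partitions : length partitions ≡ count 0 0 n k
  length-partitions = ≡.trans (≡.sym (length-map arcList partitions)) (≡.trans
    (unique∧set⇒length arcLists-unique (diagrams-unique n k 0 [] [] ([] ∷ [])) forward backward)
    (length-diagrams n k 0 [] []))

CT≡count : ∀ n k → CT (suc n) k ≡ count 0 0 n k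
CT≡count n k = length-partitions {n} {k} _

theorem1p2 : ∃[ s ] ∃[ t ]
    HasSum (λ n → sum {n} (λ k → CT n (toℕ k) · (x ^ n * y ^ toℕ k))) s
    × (∀ n → 1 ≤ n →
    IsQuotient (t n)
    (x ^ n * (1# + x * y) ^ (n C 2))
    (product {n} (λ k → 1# - (1# + x * y) ^ toℕ k * (x * y))))
    × HasSum t s
-- Both sums equal this series. The factor x stands for the first element, which is present before
-- any continuation, so `CT (suc n) k` is the coefficient of `Φ 0 0` at `n` and `k`.
theorem1p2 = x * Φ 0 0 , term ,
    coefficients-hasSum CT (x*-zero (Φ 0 0))
      (λ n j _ → ≡.trans (x*-suc (Φ 0 0) n j) (≡.cong ℤ.+_ (≡.sym (CT≡count n j))))
      (λ n j n<j → ≡.trans (x*-suc (Φ 0 0) n j) (≡.cong ℤ.+_ (count-zero 0 0 n<j)))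
  , (λ n _ → term-isQuotient n)
  , term-hasSum
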